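{- Fix a finite set $\Gamma$ of colours and consider only graphs whose colours lie in $\Gamma$. Let $k,d\ge 1$. Then there is a finite set $\mathcal F_{k,d}$ of graphs of tree depth at most $k$, computable from $k$ and $d$, such that for all graphs $G,G'$ of maximum degree at most $d$ the following are equivalent. (i) $\hom(F,G)=\hom(F,G')$ for all $F\in\mathcal F_{k,d}$. (ii) $G$ and $G'$ satisfy the same $\mathsf{C}_k$-sentences.
   Context: Graphs are finite, undirected, vertex-coloured triples $(V(G),E(G),\gamma^G)$ with $\gamma^G:V(G)\to\Gamma$. A homomorphism preserves edges and colours; $\hom(F,G)$ counts homomorphisms from $F$ to $G$. A forest is a finite poset $(V,\preceq)$ in which each $\{u:u\preceq t\}$ is a chain; its height is the maximum number of elements of a chain. An elimination forest of a graph $G$ is a forest on $V(G)$ such that $u\preceq v$ or $v\preceq u$ for every edge $uv$. The tree depth of $G$ is the minimum height of an elimination forest of $G$. $\mathsf{C}$ is first-order logic with counting: atomic formulas $x=y$, $E(x,y)$, $\gamma(x)=c$, closed under $\neg$, $\vee$ and counting quantifiers $\exists^{\ge p}x\,\varphi$ (at least $p$ distinct witnesses). Quantifier rank counts nesting depth of counting quantifiers; $\mathsf{C}_k$ consists of formulas of quantifier rank at most $k$. -}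

module Defs where

open import Data.Nat using (ℕ; zero; suc; _+_; _≤_; _⊔_)
open import Data.Fin using (Fin; zero; suc; _≟_)
open import Data.Bool using (Bool; true; false; _∧_; _∨_; not; if_then_else_)
open import Data.List using (List; []; _∷_; map; concatMap; allFin; length; foldr)
open import Data.List.Relation.Unary.Unique.Propositional using (Unique)
open import Data.List.Relation.Unary.AllPairs using (AllPairs)
open import Data.Product using (Σ; _×_)
open import Data.Sum using (_⊎_)
open import Relation.Binary.Structures using (IsPartialOrder)
open import Relation.Binary.PropositionalEquality using (_≡_)
open import Relation.Nullary.Decidable using (⌊_⌋)

record Graph (c : ℕ) : Set where
  field
    size   : ℕ
    adj    : Fin size → Fin size → Bool
    sym    : ∀ i j → adj i j ≡ adj j i
    irrefl : ∀ i → adj i i ≡ false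
    col    : Fin size → Fin c
open Graph public

allB : ∀ {A : Set} → List A → (A → Bool) → Bool
allB xs p = foldr (λ x b → p x ∧ b) true xs

countB : ∀ {A : Set} → List A → (A → Bool) → ℕ
countB xs p = foldr (λ x n → if p x then suc n else n) 0 xs

eqFin : ∀ {n} → Fin n → Fin n → Bool
eqFin i j = ⌊ i ≟ j ⌋

consF : ∀ {m n} → Fin n → (Fin m → Fin n) → Fin (suc m) → Fin n
consF v f zero    = v
consF v f (suc i) = f i

allFuns : (m n : ℕ) → List (Fin m → Fin n)
allFuns zero    n = (λ ()) ∷ []
allFuns (suc m) n = concatMap (λ f → map (λ v → consF v f) (allFin n)) (allFuns m n)

isHom : ∀ {c} (F G : Graph c) → (Fin (size F) → Fin (size G)) → Bool
isHom F G f =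
  allB (allFin (size F)) (λ i →
    allB (allFin (size F)) (λ j → not (adj F i j) ∨ adj G (f i) (f j)))
  ∧ allB (allFin (size F)) (λ i → eqFin (col F i) (col G (f i)))

hom : ∀ {c} → Graph c → Graph c → ℕ
hom F G = countB (allFuns (size F) (size G)) (isHom F G)

degree : ∀ {c} (G : Graph c) → Fin (size G) → ℕ
degree G v = countB (allFin (size G)) (adj G v)

MaxDegree≤ : ∀ {c} → Graph c → ℕ → Set
MaxDegree≤ G d = ∀ v → degree G v ≤ d

record Forest (n : ℕ) : Set₁ where
  field
    _≼_       : Fin n → Fin n → Set
    isPO      : IsPartialOrder _≡_ _≼_
    downChain : ∀ {t u v} → u ≼ t → v ≼ t → (u ≼ v) ⊎ (v ≼ u)
open Forest public

Comparable : ∀ {n} → Forest n → Fin n → Fin n → Set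
Comparable Fo u v = (_≼_ Fo u v) ⊎ (_≼_ Fo v u)

IsChain : ∀ {n} → Forest n → List (Fin n) → Set
IsChain Fo xs = Unique xs × AllPairs (Comparable Fo) xs

Height≤ : ∀ {n} → Forest n → ℕ → Set
Height≤ Fo k = ∀ xs → IsChain Fo xs → length xs ≤ k

IsEliminationForest : ∀ {c} (G : Graph c) → Forest (size G) → Set
IsEliminationForest G Fo = ∀ u v → adj G u v ≡ true → Comparable Fo u v

TreeDepth≤ : ∀ {c} → Graph c → ℕ → Set₁
TreeDepth≤ G k = Σ (Forest (size G)) λ Fo → IsEliminationForest G Fo × Height≤ Fo k

-- Counting logic C, de Bruijn style: Formula c m has m variables in scope.

data Formula (c : ℕ) : ℕ → Set where
  eq    : ∀ {m} → Fin m → Fin m → Formula c m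
  edge  : ∀ {m} → Fin m → Fin m → Formula c m
  colr  : ∀ {m} → Fin m → Fin c → Formula c m
  neg   : ∀ {m} → Formula c m → Formula c m
  disj  : ∀ {m} → Formula c m → Formula c m → Formula c m
  ∃≥    : ∀ {m} → ℕ → Formula c (suc m) → Formula c m

qr : ∀ {c m} → Formula c m → ℕ
qr (eq x y)   = 0
qr (edge x y) = 0
qr (colr x a) = 0
qr (neg φ)    = qr φ
qr (disj φ ψ) = qr φ ⊔ qr ψ
qr (∃≥ p φ)   = suc (qr φ)

Sentence : ℕ → Set
Sentence c = Formula c 0

sat : ∀ {c m} (G : Graph c) → Formula c m → (Fin m → Fin (size G)) → Bool
sat G (eq x y)   ρ = eqFin (ρ x) (ρ y)
sat G (edge x y) ρ = adj G (ρ x) (ρ y)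
sat G (colr x a) ρ = eqFin (col G (ρ x)) a
sat G (neg φ)    ρ = not (sat G φ ρ)
sat G (disj φ ψ) ρ = sat G φ ρ ∨ sat G ψ ρ
sat G (∃≥ p φ)   ρ = ⌊ p Data.Nat.≤? countB (allFin (size G)) (λ v → sat G φ (consF v ρ)) ⌋

models : ∀ {c} (G : Graph c) → Sentence c → Bool
models G φ = sat G φ (λ ())

Ck-equiv : ∀ {c} → ℕ → Graph c → Graph c → Set
Ck-equiv k G G' = ∀ (φ : Sentence _) → qr φ ≤ k → models G φ ≡ models G' φ

{-# OPTIONS --safe #-}
module Submission where

-- hom(F , –) for F of tree depth k is a k-fold nested sum of products along an elimination forest.
-- With some vertices labelled, a subpattern connected to a label has a bounded number of
-- extensions in a graph of degree at most d, while a subpattern connected to no label counts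
-- the same thing whatever the labels are. So whether v and v' extend two labelled tuples alike
-- depends on finitely many bounded numbers. How many vertices v realise given values of
-- these numbers is found by polynomial interpolation from the sums over v of their monomials,
-- and these sums are again homomorphism counts, with one more quantifier and one label less.
-- Hence finitely many counts let Duplicator win the k-round bijection game. Conversely,
-- "the nested sum is at least a" is a formula of quantifier rank k, for every a.

open import Defs
open import Data.Bool using (Bool; true; false; _∧_; _∨_; not)
import Data.Bool.Properties as Bool
open import Data.Empty using (⊥-elim)
open import Data.Fin using (Fin; zero; suc; splitAt; _↑ˡ_; _↑ʳ_)
import Data.Fin as Fin
import Data.Fin.Properties as Finₚ
open import Data.Integer using (ℤ; 0ℤ; 1ℤ) renaming (+_ to ⁺_)
import Data.Integer as ℤ
import Data.Integer.Properties as ℤₚ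
import Data.Integer.Tactic.RingSolver as ℤ-Solver
open import Data.List using (List; []; _∷_; _++_; map; concatMap; mapMaybe; allFin; tabulate; length; upTo; downFrom; filter; lookup)
import Data.List.Properties as Listₚ
open import Data.List.Membership.Propositional using (_∈_; _∉_; lose)
import Data.List.Membership.Propositional.Properties as ∈ₚ
open import Data.List.Relation.Unary.All using (All; []; _∷_)
import Data.List.Relation.Unary.All as All
import Data.List.Relation.Unary.All.Properties as Allₚ
open import Data.List.Relation.Unary.AllPairs using (AllPairs; []; _∷_)
open import Data.List.Relation.Unary.Any using (here; there)
open import Data.Maybe using (Maybe; just; nothing)
import Data.Maybe as Maybe
open import Data.Nat using (ℕ; zero; suc; _+_; _*_; _∸_; _^_; _≤_; _<_; _⊔_; _⊓_; z≤n; s≤s; _≟_; _≤?_)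
import Data.Nat.Properties as ℕₚ
open import Data.Nat.Tactic.RingSolver using (solve-∀)
open import Data.Product using (Σ; ∃; _×_; _,_; proj₁; proj₂)
open import Data.Sum using (_⊎_; inj₁; inj₂)
import Data.Sum as Sum
open import Data.Unit using (⊤; tt)
open import Function.Base using (_∘_; id)
open import Function.Bundles using (_⇔_; mk⇔)
open import Relation.Binary.PropositionalEquality as ≡ using (_≡_; _≢_; _≗_; refl; cong; cong₂; subst; module ≡-Reasoning)
open import Relation.Nullary using (¬_; Dec; yes; no)
open import Relation.Nullary.Decidable using (⌊_⌋; ¬?; isYes≗does; _⊎-dec_)

-- The family must be fixed before the graphs are known, while interpolation needs a bound on each
-- statistic that is valid in all graphs of degree at most `d`. Hence the invariant `Linked`:
-- whatever lies below the root of a test pattern is connected to that root. A pattern attached to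
-- the newest label then has a value bounded in terms of `d` and the pattern alone. Products of such
-- patterns hang connectedly below the vertex that replaces this label, so the invariant passes to
-- the preceding round. With r rounds left, the patterns have depth at most r. Equality of vertices
-- needs separate care, since no pattern expresses it. The mixed moments that involve the indicator
-- of "v is the old label i" collapse to values at that label, and these are values of patterns in
-- which the newest label is identified with i.

private variable
  X Y : Set

-- Booleans and finite sums.

b2n : Bool → ℕ
b2n true  = 1
b2n false = 0

b2n≤1 : ∀ b → b2n b ≤ 1
b2n≤1 true  = ℕₚ.≤-refl
b2n≤1 false = z≤n

b2n-injective : ∀ {a b} → b2n a ≡ b2n b → a ≡ b
b2n-injective {true}  {true}  _ = refl
b2n-injective {false} {false} _ = refl

b2n-∧ : ∀ a b → b2n (a ∧ b) ≡ b2n a * b2n b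
b2n-∧ true  b = ≡.sym (ℕₚ.+-identityʳ _)
b2n-∧ false b = refl

b2n≢0 : ∀ {b} → b2n b ≢ 0 → b ≡ true
b2n≢0 {true}  _ = refl
b2n≢0 {false} p = ⊥-elim (p refl)

∧-true : ∀ {a b} → a ∧ b ≡ true → a ≡ true × b ≡ true
∧-true {true} {true} _ = refl , refl

bool-ext : ∀ {a b} → (a ≡ true → b ≡ true) → (b ≡ true → a ≡ true) → a ≡ b
bool-ext {true}  {b}     f g = ≡.sym (f refl)
bool-ext {false} {true}  f g = g refl
bool-ext {false} {false} f g = refl

∧-intro : ∀ {a b} → a ≡ true → b ≡ true → a ∧ b ≡ true
∧-intro refl refl = refl

⇒-elim : ∀ {a b} → not a ∨ b ≡ true → a ≡ true → b ≡ true
⇒-elim h refl = h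

⇒-intro : ∀ {a b} → (a ≡ true → b ≡ true) → not a ∨ b ≡ true
⇒-intro {true}  h = h refl
⇒-intro {false} h = refl

allB⁺ : ∀ (xs : List X) {p} → (∀ x → x ∈ xs → p x ≡ true) → allB xs p ≡ true
allB⁺ []       h = refl
allB⁺ (x ∷ xs) h = ∧-intro (h x (here refl)) (allB⁺ xs λ y q → h y (there q))

allB⁻ : ∀ {xs : List X} {p x} → allB xs p ≡ true → x ∈ xs → p x ≡ true
allB⁻ h (here refl) = proj₁ (∧-true h)
allB⁻ h (there q)   = allB⁻ (proj₂ (∧-true h)) q

dec-true : ∀ {P : Set} (d : Dec P) → P → ⌊ d ⌋ ≡ true
dec-true (yes _) p = refl
dec-true (no ¬p) p = ⊥-elim (¬p p)

dec-false : ∀ {P : Set} (d : Dec P) → ¬ P → ⌊ d ⌋ ≡ false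
dec-false (yes p) ¬p = ⊥-elim (¬p p)
dec-false (no _)  _  = refl

true-dec : ∀ {P : Set} (d : Dec P) → ⌊ d ⌋ ≡ true → P
true-dec (yes p) _ = p

eqFin⇒≡ : ∀ {n} {i j : Fin n} → eqFin i j ≡ true → i ≡ j
eqFin⇒≡ {i = i} {j} = true-dec (i Fin.≟ j)

eqFin-refl : ∀ {n} (i : Fin n) → eqFin i i ≡ true
eqFin-refl i = dec-true (i Fin.≟ i) refl

*-right-comm : ∀ a b c → a * b * c ≡ a * c * b
*-right-comm = solve-∀

*-≢0 : ∀ {a b} → a * b ≢ 0 → a ≢ 0 × b ≢ 0
*-≢0 {a} p = (λ { refl → p refl }) , (λ { refl → p (ℕₚ.*-zeroʳ a) })

∑ : List X → (X → ℕ) → ℕ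
∑ []       f = 0
∑ (x ∷ xs) f = f x + ∑ xs f

∑-cong : ∀ (xs : List X) {f g} → f ≗ g → ∑ xs f ≡ ∑ xs g
∑-cong []       e = refl
∑-cong (x ∷ xs) e = cong₂ _+_ (e x) (∑-cong xs e)

∑-zero : ∀ (xs : List X) {f} → (∀ x → f x ≡ 0) → ∑ xs f ≡ 0
∑-zero []       e = refl
∑-zero (x ∷ xs) e = cong₂ _+_ (e x) (∑-zero xs e)

∑-+ : ∀ (xs : List X) f g → ∑ xs (λ x → f x + g x) ≡ ∑ xs f + ∑ xs g
∑-+ []       f g = refl
∑-+ (x ∷ xs) f g rewrite ∑-+ xs f g = lemma (f x) (g x) (∑ xs f) (∑ xs g)
  where
  lemma : ∀ a b c d → a + b + (c + d) ≡ a + c + (b + d)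
  lemma = solve-∀

∑-*ʳ : ∀ (xs : List X) f k → ∑ xs (λ x → f x * k) ≡ ∑ xs f * k
∑-*ʳ []       f k = refl
∑-*ʳ (x ∷ xs) f k rewrite ∑-*ʳ xs f k = ≡.sym (ℕₚ.*-distribʳ-+ k (f x) (∑ xs f))

∑-*ˡ : ∀ (xs : List X) f k → ∑ xs (λ x → k * f x) ≡ k * ∑ xs f
∑-*ˡ []       f k = ≡.sym (ℕₚ.*-zeroʳ k)
∑-*ˡ (x ∷ xs) f k rewrite ∑-*ˡ xs f k = ≡.sym (ℕₚ.*-distribˡ-+ k (f x) (∑ xs f))

∑-swap : ∀ (xs : List X) (ys : List Y) (f : X → Y → ℕ) →
  ∑ xs (λ x → ∑ ys (f x)) ≡ ∑ ys (λ y → ∑ xs (λ x → f x y))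
∑-swap []       ys f = ≡.sym (∑-zero ys (λ _ → refl))
∑-swap (x ∷ xs) ys f =
  ≡.trans (cong (∑ ys (f x) +_) (∑-swap xs ys f)) (≡.sym (∑-+ ys (f x) _))

∑-mono : ∀ (xs : List X) {f g} → (∀ x → f x ≤ g x) → ∑ xs f ≤ ∑ xs g
∑-mono []       e = z≤n
∑-mono (x ∷ xs) e = ℕₚ.+-mono-≤ (e x) (∑-mono xs e)

∑-≤-length : ∀ (xs : List X) {f} k → (∀ x → f x ≤ k) → ∑ xs f ≤ length xs * k
∑-≤-length []       k e = z≤n
∑-≤-length (x ∷ xs) k e = ℕₚ.+-mono-≤ (e x) (∑-≤-length xs k e)

∑-∈ : ∀ {xs : List X} {x} f → x ∈ xs → f x ≤ ∑ xs f
∑-∈ f (here refl)          = ℕₚ.m≤m+n _ _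
∑-∈ {xs = y ∷ _} f (there p) = ℕₚ.≤-trans (∑-∈ f p) (ℕₚ.m≤n+m _ (f y))

∑-≢0 : ∀ (xs : List X) {f} → ∑ xs f ≢ 0 → ∃ λ x → x ∈ xs × f x ≢ 0
∑-≢0 []       p = ⊥-elim (p refl)
∑-≢0 (x ∷ xs) {f} p with f x ≟ 0
... | no q = x , here refl , q
... | yes q with ∑-≢0 xs {f} (λ r → p (cong₂ _+_ q r))
...   | y , y∈ , r = y , there y∈ , r

countB≡∑ : ∀ (xs : List X) p → countB xs p ≡ ∑ xs (b2n ∘ p)
countB≡∑ []       p = refl
countB≡∑ (x ∷ xs) p with p x
... | true  = cong suc (countB≡∑ xs p)
... | false = countB≡∑ xs p

∑-++ : ∀ (xs ys : List X) f → ∑ (xs ++ ys) f ≡ ∑ xs f + ∑ ys f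
∑-++ []       ys f = refl
∑-++ (x ∷ xs) ys f = ≡.trans (cong (f x +_) (∑-++ xs ys f)) (≡.sym (ℕₚ.+-assoc (f x) _ _))

∑-map : ∀ (g : X → Y) xs f → ∑ (map g xs) f ≡ ∑ xs (f ∘ g)
∑-map g []       f = refl
∑-map g (x ∷ xs) f = cong (f (g x) +_) (∑-map g xs f)

∑-concatMap : ∀ (g : X → List Y) xs f → ∑ (concatMap g xs) f ≡ ∑ xs (λ x → ∑ (g x) f)
∑-concatMap g []       f = refl
∑-concatMap g (x ∷ xs) f =
  ≡.trans (∑-++ (g x) _ f) (cong (∑ (g x) f +_) (∑-concatMap g xs f))

∑-tabulate : ∀ {n} (g : Fin n → X) f → ∑ (tabulate g) f ≡ ∑ (allFin n) (f ∘ g)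
∑-tabulate g f = ≡.trans (cong (λ l → ∑ l f) (≡.sym (Listₚ.map-tabulate id g))) (∑-map g (allFin _) f)

∑-allFin-suc : ∀ n (f : Fin (suc n) → ℕ) → ∑ (allFin (suc n)) f ≡ f zero + ∑ (allFin n) (f ∘ suc)
∑-allFin-suc n f = cong (f zero +_) (∑-tabulate suc f)

∑-dirac : ∀ {n} (w : Fin n → ℕ) u → ∑ (allFin n) (λ v → w v * b2n (eqFin v u)) ≡ w u
∑-dirac {suc n} w zero =
  ≡.trans (∑-allFin-suc n _)
    (≡.trans (cong₂ _+_ (ℕₚ.*-identityʳ _) (∑-zero (allFin n) (λ v → ℕₚ.*-zeroʳ (w (suc v)))))
             (ℕₚ.+-identityʳ _))
∑-dirac {suc n} w (suc u) =
  ≡.trans (∑-allFin-suc n _)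
    (cong₂ _+_ (ℕₚ.*-zeroʳ (w zero))
      (≡.trans (∑-cong (allFin n) (λ v → cong (λ b → w (suc v) * b2n b)
                 (≡.trans (isYes≗does (suc v Fin.≟ suc u)) (≡.sym (isYes≗does (v Fin.≟ u))))))
               (∑-dirac (w ∘ suc) u)))

δ : ℕ → ℕ → ℕ
δ a b = b2n ⌊ a ≟ b ⌋

δ≢0 : ∀ {a b} → δ a b ≢ 0 → a ≡ b
δ≢0 {a} {b} p = true-dec (a ≟ b) (b2n≢0 p)

∑-δ : ∀ M a → ∑ (downFrom M) (δ a) ≡ b2n ⌊ suc a ≤? M ⌋
∑-δ zero    a = refl
∑-δ (suc M) a with a ≟ M
... | yes refl = ≡.trans (cong suc (≡.trans (∑-δ a a) (cong b2n (dec-false (suc a ≤? a) ℕₚ.1+n≰n))))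
                         (≡.sym (cong b2n (dec-true (suc a ≤? suc a) ℕₚ.≤-refl)))
... | no  a≢M  = ≡.trans (∑-δ M a) (cong b2n (bool-ext
  (λ e → dec-true (suc a ≤? suc M) (ℕₚ.m≤n⇒m≤1+n (true-dec (suc a ≤? M) e)))
  (λ e → dec-true (suc a ≤? M) (ℕₚ.≤∧≢⇒< (ℕₚ.≤-pred (true-dec (suc a ≤? suc M) e)) a≢M))))

-- Interpolation in one variable.

∑ᶻ : List X → (X → ℤ) → ℤ
∑ᶻ []       f = 0ℤ
∑ᶻ (x ∷ xs) f = f x ℤ.+ ∑ᶻ xs f

∑ᶻ-cong : ∀ (xs : List X) {f g} → f ≗ g → ∑ᶻ xs f ≡ ∑ᶻ xs g
∑ᶻ-cong []       e = refl
∑ᶻ-cong (x ∷ xs) e = cong₂ ℤ._+_ (e x) (∑ᶻ-cong xs e)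

∑ᶻ-linear : ∀ (xs : List X) g b h → ∑ᶻ xs (λ x → g x ℤ.- b ℤ.* h x) ≡ ∑ᶻ xs g ℤ.- b ℤ.* ∑ᶻ xs h
∑ᶻ-linear []       g b h = ≡.sym (cong (λ z → 0ℤ ℤ.- z) (ℤₚ.*-zeroʳ b))
∑ᶻ-linear (x ∷ xs) g b h rewrite ∑ᶻ-linear xs g b h = lemma (g x) b (h x) (∑ᶻ xs g) (∑ᶻ xs h)
  where
  lemma : ∀ a b c d e → (a ℤ.- b ℤ.* c) ℤ.+ (d ℤ.- b ℤ.* e) ≡ (a ℤ.+ d) ℤ.- b ℤ.* (c ℤ.+ e)
  lemma = ℤ-Solver.solve-∀

∑ᶻ-scale : ∀ (xs : List X) f C → ∑ᶻ xs (λ x → ⁺ f x ℤ.* C) ≡ ⁺ ∑ xs f ℤ.* C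
∑ᶻ-scale []       f C = refl
∑ᶻ-scale (x ∷ xs) f C rewrite ∑ᶻ-scale xs f C = ≡.sym (ℤₚ.*-distribʳ-+ C (⁺ f x) (⁺ ∑ xs f))

-- An unnormalised Lagrange polynomial: without division all values stay integers, and a nonzero
-- value at the one remaining point is enough to cancel it.
vanishing : List ℕ → ℤ → ℤ
vanishing []       t = 1ℤ
vanishing (b ∷ bs) t = (t ℤ.- ⁺ b) ℤ.* vanishing bs t

vanishing-∈ : ∀ {b bs} → b ∈ bs → vanishing bs (⁺ b) ≡ 0ℤ
vanishing-∈ {b} {_ ∷ bs} (here refl) =
  cong (ℤ._* vanishing bs (⁺ b)) (ℤₚ.+-inverseʳ (⁺ b))
vanishing-∈ {b} {c ∷ _} (there p) =
  ≡.trans (cong ((⁺ b ℤ.- ⁺ c) ℤ.*_) (vanishing-∈ p)) (ℤₚ.*-zeroʳ (⁺ b ℤ.- ⁺ c))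

vanishing-∉ : ∀ {b} bs → b ∉ bs → vanishing bs (⁺ b) ≢ 0ℤ
vanishing-∉     []       _ ()
vanishing-∉ {b} (c ∷ bs) p q with ℤₚ.i*j≡0⇒i≡0∨j≡0 (⁺ b ℤ.- ⁺ c) q
... | inj₁ r = p (here (ℤₚ.+-injective (ℤₚ.i-j≡0⇒i≡j (⁺ b) (⁺ c) r)))
... | inj₂ r = vanishing-∉ bs (p ∘ there) r

module _ {xs : List X} {ys : List Y} where

  -- Since (t - b) t^e p(t) = t^(e+1) p(t) - b t^e p(t), each linear factor costs one more exponent;
  -- this is the origin of `e + length bs ≤ N`.
  moments⇒vanishing : ∀ (w f : X → ℕ) (w' f' : Y → ℕ) N →
    (∀ e → e ≤ N → ∑ xs (λ x → w x * f x ^ e) ≡ ∑ ys (λ y → w' y * f' y ^ e)) →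
    ∀ bs e → e + length bs ≤ N →
    ∑ᶻ xs (λ x → ⁺ (w x * f x ^ e) ℤ.* vanishing bs (⁺ f x)) ≡
    ∑ᶻ ys (λ y → ⁺ (w' y * f' y ^ e) ℤ.* vanishing bs (⁺ f' y))
  moments⇒vanishing w f w' f' N mom []       e le =
    ≡.trans (∑ᶻ-scale xs _ 1ℤ)
      (≡.trans (cong (λ s → ⁺ s ℤ.* 1ℤ) (mom e (subst (_≤ N) (ℕₚ.+-identityʳ e) le)))
               (≡.sym (∑ᶻ-scale ys _ 1ℤ)))
  moments⇒vanishing w f w' f' N mom (b ∷ bs) e le =
    ≡.trans (expand xs w f)
      (≡.trans (cong₂ (λ s t → s ℤ.- ⁺ b ℤ.* t)
                 (moments⇒vanishing w f w' f' N mom bs (suc e) (subst (_≤ N) (ℕₚ.+-suc e (length bs)) le))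
                 (moments⇒vanishing w f w' f' N mom bs e
                    (ℕₚ.≤-trans (ℕₚ.+-monoʳ-≤ e (ℕₚ.n≤1+n (length bs))) le)))
               (≡.sym (expand ys w' f')))
    where
    identity : ∀ u t p b v → (u ℤ.* p) ℤ.* ((t ℤ.- b) ℤ.* v) ≡ (u ℤ.* (t ℤ.* p)) ℤ.* v ℤ.- b ℤ.* ((u ℤ.* p) ℤ.* v)
    identity = ℤ-Solver.solve-∀
    expand : ∀ {Z : Set} (zs : List Z) (w f : Z → ℕ) →
      ∑ᶻ zs (λ x → ⁺ (w x * f x ^ e) ℤ.* vanishing (b ∷ bs) (⁺ f x)) ≡
      ∑ᶻ zs (λ x → ⁺ (w x * f x ^ suc e) ℤ.* vanishing bs (⁺ f x))
        ℤ.- ⁺ b ℤ.* ∑ᶻ zs (λ x → ⁺ (w x * f x ^ e) ℤ.* vanishing bs (⁺ f x))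
    expand zs w f = ≡.trans (∑ᶻ-cong zs pointwise) (∑ᶻ-linear zs _ (⁺ b) _)
      where
      pointwise : ∀ x → ⁺ (w x * f x ^ e) ℤ.* vanishing (b ∷ bs) (⁺ f x) ≡
        ⁺ (w x * f x ^ suc e) ℤ.* vanishing bs (⁺ f x) ℤ.- ⁺ b ℤ.* (⁺ (w x * f x ^ e) ℤ.* vanishing bs (⁺ f x))
      pointwise x = ≡.trans
        (cong (ℤ._* vanishing (b ∷ bs) (⁺ f x)) (ℤₚ.pos-* (w x) (f x ^ e)))
        (≡.trans (identity (⁺ w x) (⁺ f x) (⁺ (f x ^ e)) (⁺ b) (vanishing bs (⁺ f x)))
          (≡.sym (cong₂ (λ s t → s ℤ.* vanishing bs (⁺ f x) ℤ.- ⁺ b ℤ.* (t ℤ.* vanishing bs (⁺ f x)))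
            (≡.trans (ℤₚ.pos-* (w x) (f x ^ suc e)) (cong (⁺ w x ℤ.*_) (ℤₚ.pos-* (f x) (f x ^ e))))
            (ℤₚ.pos-* (w x) (f x ^ e)))))

  -- Test the moments against the polynomial vanishing at every value below M other than a.
  moments⇒level-weight : ∀ (w f : X → ℕ) (w' f' : Y → ℕ) M →
    (∀ x → f x < M) → (∀ y → f' y < M) →
    (∀ e → e ≤ M → ∑ xs (λ x → w x * f x ^ e) ≡ ∑ ys (λ y → w' y * f' y ^ e)) →
    ∀ a → ∑ xs (λ x → w x * δ (f x) a) ≡ ∑ ys (λ y → w' y * δ (f' y) a)
  moments⇒level-weight w f w' f' M lt lt' mom a =
    ℤₚ.+-injective (ℤₚ.*-cancelʳ-≡ _ _ C {{ℤ.≢-nonZero C≢0}}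
      (≡.trans (≡.sym (isolate xs w f lt))
        (≡.trans (moments⇒vanishing w f w' f' M mom bs 0 length-bs) (isolate ys w' f' lt'))))
    where
    bs = filter (λ b → ¬? (b ≟ a)) (upTo M)
    C = vanishing bs (⁺ a)
    C≢0 : C ≢ 0ℤ
    C≢0 = vanishing-∉ bs (λ a∈ → proj₂ (∈ₚ.∈-filter⁻ (λ b → ¬? (b ≟ a)) {xs = upTo M} a∈) refl)
    length-bs : length bs ≤ M
    length-bs = ℕₚ.≤-trans (Listₚ.length-filter (λ b → ¬? (b ≟ a)) (upTo M)) (ℕₚ.≤-reflexive (Listₚ.length-upTo M))
    isolate : ∀ {Z : Set} (zs : List Z) (w f : Z → ℕ) → (∀ z → f z < M) →
      ∑ᶻ zs (λ z → ⁺ (w z * f z ^ 0) ℤ.* vanishing bs (⁺ f z)) ≡ ⁺ ∑ zs (λ z → w z * δ (f z) a) ℤ.* C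
    isolate zs w f lt = ≡.trans (∑ᶻ-cong zs pointwise) (∑ᶻ-scale zs _ C)
      where
      pointwise : ∀ z → ⁺ (w z * f z ^ 0) ℤ.* vanishing bs (⁺ f z) ≡ ⁺ (w z * δ (f z) a) ℤ.* C
      pointwise z with f z ≟ a
      ... | yes p rewrite p = refl
      ... | no  p = ≡.trans
        (≡.trans (cong (⁺ (w z * 1) ℤ.*_) (vanishing-∈ (∈ₚ.∈-filter⁺ (λ b → ¬? (b ≟ a)) (∈ₚ.∈-upTo⁺ (lt z)) p)))
                 (ℤₚ.*-zeroʳ (⁺ (w z * 1))))
        (≡.sym (cong (λ s → ⁺ s ℤ.* C) (ℕₚ.*-zeroʳ (w z))))

-- Joint distribution of several bounded statistics.

record Statistic (X Y : Set) : Set where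
  field
    left   : X → ℕ
    right  : Y → ℕ
    bound  : ℕ
    left<  : ∀ x → left x < bound
    right< : ∀ y → right y < bound
open Statistic

Agree : List (Statistic X Y) → X → Y → Set
Agree ss x y = All (λ s → left s x ≡ right s y) ss

module Interpolation {X Y : Set} (xs : List X) (ys : List Y) where

  -- Mixed moments with all exponents in a box. Powers already chosen are stored in the weights,
  -- which spares explicit monomials and permits induction on the list.
  Moments : List (Statistic X Y) → (X → ℕ) → (Y → ℕ) → Set
  Moments []       w w' = ∑ xs w ≡ ∑ ys w'
  Moments (s ∷ ss) w w' =
    ∀ e → e ≤ bound s → Moments ss (λ x → w x * left s x ^ e) (λ y → w' y * right s y ^ e)

  Moments-cong : ∀ ss {w u w' u'} → w ≗ u → w' ≗ u' → Moments ss w w' → Moments ss u u'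
  Moments-cong []       p q m = ≡.trans (≡.sym (∑-cong xs p)) (≡.trans m (∑-cong ys q))
  Moments-cong (s ∷ ss) p q m e le =
    Moments-cong ss (λ x → cong (_* left s x ^ e) (p x)) (λ y → cong (_* right s y ^ e) (q y)) (m e le)

  -- For fixed exponents of the other statistics, their powers are merely a further weight, so
  -- interpolation in `s` alone applies; the commutations only reorder the factors of that weight.
  Moments-level : ∀ s ss {w w'} → Moments (s ∷ ss) w w' → ∀ a →
    Moments ss (λ x → w x * δ (left s x) a) (λ y → w' y * δ (right s y) a)
  Moments-level s [] {w} {w'} m a =
    moments⇒level-weight {xs = xs} {ys} w (left s) w' (right s) (bound s) (left< s) (right< s) m a
  Moments-level s (t ∷ ss) {w} {w'} m a e le =
    Moments-cong ss (λ x → *-right-comm (w x) _ _) (λ y → *-right-comm (w' y) _ _)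
      (Moments-level s ss {λ x → w x * left t x ^ e} {λ y → w' y * right t y ^ e}
        (λ e' le' → Moments-cong ss (λ x → *-right-comm (w x) _ _) (λ y → *-right-comm (w' y) _ _) (m e' le' e le))
        a)

  ∑-by-level : ∀ s {g g'} →
    (∀ a → ∑ xs (λ x → g x * δ (left s x) a) ≡ ∑ ys (λ y → g' y * δ (right s y) a)) →
    ∑ xs g ≡ ∑ ys g'
  ∑-by-level s {g} {g'} h =
    ≡.trans (split xs g (left s) (left< s))
      (≡.trans (∑-cong (downFrom (bound s)) h) (≡.sym (split ys g' (right s) (right< s))))
    where
    split : ∀ {Z : Set} (zs : List Z) g f → (∀ z → f z < bound s) →
      ∑ zs g ≡ ∑ (downFrom (bound s)) (λ a → ∑ zs (λ z → g z * δ (f z) a))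
    split zs g f lt = ≡.trans
      (∑-cong zs λ z → ≡.sym (≡.trans (∑-*ˡ (downFrom (bound s)) _ (g z))
        (≡.trans (cong (g z *_) (≡.trans (∑-δ (bound s) (f z)) (cong b2n (dec-true (suc (f z) ≤? bound s) (lt z))))) (ℕₚ.*-identityʳ (g z)))))
      (∑-swap zs (downFrom (bound s)) _)

  -- Fixing the level of each statistic in turn leaves weights supported where `P` and `P'` are
  -- constant with a common value, and there only the total weight counts.
  moments⇒count : ∀ ss {w w'} → Moments ss w w' → ∀ (P : X → Bool) (P' : Y → Bool) →
    (∀ x y → w x ≢ 0 → w' y ≢ 0 → Agree ss x y → P x ≡ P' y) →
    ∑ xs (λ x → w x * b2n (P x)) ≡ ∑ ys (λ y → w' y * b2n (P' y))
  moments⇒count [] {w} {w'} m P P' h with ∑ xs w ≟ 0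
  -- Total weight zero leaves no pair from which to read the common value, but then every summand is
  -- zero.
  ... | yes z = ≡.trans (vanish xs w P z) (≡.sym (vanish ys w' P' (≡.trans (≡.sym m) z)))
    where
    vanish : ∀ {Z : Set} (zs : List Z) w (P : Z → Bool) → ∑ zs w ≡ 0 → ∑ zs (λ z → w z * b2n (P z)) ≡ 0
    vanish zs w P z = ℕₚ.n≤0⇒n≡0 (subst (∑ zs _ ≤_) z
      (∑-mono zs λ x → subst (w x * b2n (P x) ≤_) (ℕₚ.*-identityʳ (w x)) (ℕₚ.*-monoʳ-≤ (w x) (b2n≤1 (P x)))))
  ... | no nz with ∑-≢0 xs nz | ∑-≢0 ys (λ z → nz (≡.trans m z))
  ...   | x₀ , _ , wx₀ | y₀ , _ , wy₀ = begin
    ∑ xs (λ x → w x * b2n (P x))    ≡⟨ ∑-cong xs constantˡ ⟩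
    ∑ xs (λ x → w x * b2n (P' y₀))  ≡⟨ ∑-*ʳ xs w _ ⟩
    ∑ xs w * b2n (P' y₀)            ≡⟨ cong (_* b2n (P' y₀)) m ⟩
    ∑ ys w' * b2n (P' y₀)           ≡⟨ ∑-*ʳ ys w' _ ⟨
    ∑ ys (λ y → w' y * b2n (P' y₀)) ≡⟨ ∑-cong ys constantʳ ⟨
    ∑ ys (λ y → w' y * b2n (P' y))  ∎
    where
    open ≡-Reasoning
    constantˡ : ∀ x → w x * b2n (P x) ≡ w x * b2n (P' y₀)
    constantˡ x with w x ≟ 0
    ... | yes z rewrite z = refl
    ... | no nz = cong (λ b → w x * b2n b) (h x y₀ nz wy₀ [])
    constantʳ : ∀ y → w' y * b2n (P' y) ≡ w' y * b2n (P' y₀)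
    constantʳ y with w' y ≟ 0
    ... | yes z rewrite z = refl
    ... | no nz = cong (λ b → w' y * b2n b) (≡.trans (≡.sym (h x₀ y wx₀ nz [])) (h x₀ y₀ wx₀ wy₀ []))
  moments⇒count (s ∷ ss) {w} {w'} m P P' h = ∑-by-level s λ a →
    ≡.trans (∑-cong xs (λ x → *-right-comm (w x) _ _))
      (≡.trans (moments⇒count ss (Moments-level s ss {w} {w'} m a) P P' (level a))
        (∑-cong ys (λ y → *-right-comm (w' y) _ _)))
    where
    level : ∀ a x y → w x * δ (left s x) a ≢ 0 → w' y * δ (right s y) a ≢ 0 → Agree ss x y → P x ≡ P' y
    level a x y p q ag with *-≢0 {w x} p | *-≢0 {w' y} q
    ... | p₁ , p₂ | q₁ , q₂ = h x y p₁ q₁ (≡.trans (δ≢0 p₂) (≡.sym (δ≢0 q₂)) ∷ ag)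

-- Labelled patterns, their values and their renamings.

private variable
  c m n : ℕ

-- A forest of patterns hanging from n labelled vertices, as first child and next sibling:
-- the root of node a S t u has colour a and is adjacent to the labels in S; it becomes label zero in t.
data Term (c : ℕ) : ℕ → Set where
  one  : Term c n
  node : Fin c → List (Fin n) → Term c (suc n) → Term c n → Term c n

fits : (G : Graph c) → Fin c → List (Fin n) → (Fin n → Fin (size G)) → Fin (size G) → Bool
fits G a S ρ v = eqFin a (col G v) ∧ allB S (λ i → adj G (ρ i) v)

val : (G : Graph c) → Term c n → (Fin n → Fin (size G)) → ℕ
val G one            ρ = 1
val G (node a S t u) ρ =
  ∑ (allFin (size G)) (λ v → b2n (fits G a S ρ v) * val G t (consF v ρ)) * val G u ρ

depth : Term c n → ℕ
depth one            = 0
depth (node a S t u) = suc (depth t) ⊔ depth u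

data Uses {c : ℕ} : Fin n → Term c n → Set where
  adjacent : ∀ {i : Fin n} {a S t u} → i ∈ S → Uses i (node a S t u)
  below    : ∀ {i : Fin n} {a S t u} → Uses (suc i) t → Uses i (node a S t u)
  beside   : ∀ {i : Fin n} {a S t u} → Uses i u → Uses i (node a S t u)

Attached : Fin n → List (Fin n) → Term c (suc n) → Set
Attached i S t = i ∈ S ⊎ Uses (suc i) t

uses? : ∀ (i : Fin n) (t : Term c n) → Dec (Uses i t)
attached? : ∀ (i : Fin n) S (t : Term c (suc n)) → Dec (Attached i S t)
uses? i one = no λ ()
uses? i (node a S t u) with attached? i S t | uses? i u
... | yes (inj₁ p) | _     = yes (adjacent p)
... | yes (inj₂ p) | _     = yes (below p)
... | no _         | yes p = yes (beside p)
... | no ¬p        | no ¬q = no λ where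
  (adjacent p) → ¬p (inj₁ p)
  (below p)    → ¬p (inj₂ p)
  (beside p)   → ¬q p
attached? i S t = i ∈? S ⊎-dec uses? (suc i) t
  where open import Data.List.Membership.DecPropositional Fin._≟_ using (_∈?_)

-- Every tree of the forest is connected to label zero, and recursively below its root; this is what bounds val.
data Linked {c : ℕ} : Term c (suc n) → Set where
  one  : Linked {n = n} one
  node : ∀ {a} {S : List (Fin (suc n))} {t u} →
    Attached zero S t → Linked t → Linked u → Linked (node a S t u)

lift : (Fin m → Maybe (Fin n)) → Fin (suc m) → Maybe (Fin (suc n))
lift θ zero    = just zero
lift θ (suc i) = Maybe.map suc (θ i)

-- A renaming may identify labels, and it deletes a label sent to `nothing` together with its edges;
-- the value survives when every label in use is kept and its vertex preserved.
rename : (Fin m → Maybe (Fin n)) → Term c m → Term c n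
rename θ one            = one
rename θ (node a S t u) = node a (mapMaybe θ S) (rename (lift θ) t) (rename θ u)

depth-rename : ∀ (θ : Fin m → Maybe (Fin n)) (t : Term c m) → depth (rename θ t) ≡ depth t
depth-rename θ one            = refl
depth-rename θ (node a S t u) = cong₂ (λ x y → suc x ⊔ y) (depth-rename (lift θ) t) (depth-rename θ u)

∈-mapMaybe⁺ : ∀ {θ : Fin m → Maybe (Fin n)} {i i'} S → θ i ≡ just i' → i ∈ S → i' ∈ mapMaybe θ S
∈-mapMaybe⁺ {θ = θ} (j ∷ S) e (here refl) rewrite e = here refl
∈-mapMaybe⁺ {θ = θ} (j ∷ S) e (there p) with θ j
... | just _  = there (∈-mapMaybe⁺ S e p)
... | nothing = ∈-mapMaybe⁺ S e p

lift-just : ∀ {θ : Fin m → Maybe (Fin n)} {i i'} → θ i ≡ just i' → lift θ (suc i) ≡ just (suc i')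
lift-just e rewrite e = refl

uses-rename : ∀ {θ : Fin m → Maybe (Fin n)} {i i'} {t : Term c m} →
  θ i ≡ just i' → Uses i t → Uses i' (rename θ t)
uses-rename     e (adjacent p) = adjacent (∈-mapMaybe⁺ _ e p)
uses-rename {θ = θ} e (below p) = below (uses-rename (lift-just {θ = θ} e) p)
uses-rename     e (beside p)   = beside (uses-rename e p)

attached-rename : ∀ {θ : Fin m → Maybe (Fin n)} {i i' S} {t : Term c (suc m)} →
  θ i ≡ just i' → Attached i S t → Attached i' (mapMaybe θ S) (rename (lift θ) t)
attached-rename         e (inj₁ p) = inj₁ (∈-mapMaybe⁺ _ e p)
attached-rename {θ = θ} e (inj₂ p) = inj₂ (uses-rename (lift-just {θ = θ} e) p)

linked-rename : ∀ {θ : Fin (suc m) → Maybe (Fin (suc n))} {t : Term c (suc m)} →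
  θ zero ≡ just zero → Linked t → Linked (rename θ t)
linked-rename e one          = one
linked-rename e (node p l k) = node (attached-rename e p) (linked-rename refl l) (linked-rename e k)

module _ (G : Graph c) where

  allB-mapMaybe : ∀ {θ : Fin m → Maybe (Fin n)} S {p q} →
    (∀ i → i ∈ S → ∃ λ i' → θ i ≡ just i' × q i' ≡ p i) → allB (mapMaybe θ S) q ≡ allB S p
  allB-mapMaybe []      h = refl
  allB-mapMaybe (i ∷ S) h with h i (here refl)
  ... | i' , e , r rewrite e = cong₂ _∧_ r (allB-mapMaybe S (λ j p → h j (there p)))

  val-rename : ∀ {θ : Fin m → Maybe (Fin n)} (t : Term c m) {ρ ρ'} →
    (∀ i → Uses i t → ∃ λ i' → θ i ≡ just i' × ρ' i' ≡ ρ i) → val G (rename θ t) ρ' ≡ val G t ρ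
  val-rename one h = refl
  val-rename {θ = θ} (node a S t u) {ρ} {ρ'} h = cong₂ _*_
    (∑-cong (allFin (size G)) λ v → cong₂ (λ b k → b2n (eqFin a (col G v) ∧ b) * k)
      (allB-mapMaybe S λ i p → let i' , e , r = h i (adjacent p) in i' , e , cong (λ w → adj G w v) r)
      (val-rename t (lifted v)))
    (val-rename u (λ i p → h i (beside p)))
    where
    lifted : ∀ v i → Uses i t → ∃ λ i' → lift θ i ≡ just i' × consF v ρ' i' ≡ consF v ρ i
    lifted v zero    p = zero , refl , refl
    lifted v (suc i) p = let i' , e , r = h i (below p) in suc i' , lift-just {θ = θ} e , r

  -- Walks, balls and bounds on the values of linked patterns.

  data Near : ℕ → Fin (size G) → Fin (size G) → Set where
    here : ∀ {r u} → Near r u u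
    step : ∀ {r u v w} → adj G u v ≡ true → Near r v w → Near (suc r) u w

  near-mono : ∀ {r s u v} → r ≤ s → Near r u v → Near s u v
  near-mono le       here       = here
  near-mono (s≤s le) (step e p) = step e (near-mono le p)

  near-trans : ∀ {r s u v w} → Near r u v → Near s v w → Near (r + s) u w
  near-trans {r} here q = near-mono (ℕₚ.m≤n+m _ r) q
  near-trans (step e p) q = step e (near-trans p q)

  near-sym : ∀ {r u v} → Near r u v → Near r v u
  near-sym here = here
  near-sym {suc r} {u} {w} (step {v = v} e p) =
    subst (λ s → Near s w u) (ℕₚ.+-comm r 1)
      (near-trans (near-sym p) (step (≡.trans (sym G v u) e) here))

  neighbours : Fin (size G) → List (Fin (size G))
  neighbours u = filter (λ w → adj G u w Bool.≟ true) (allFin (size G))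

  length-neighbours : ∀ u → length (neighbours u) ≡ degree G u
  length-neighbours u = go (allFin (size G))
    where
    go : ∀ ws → length (filter (λ w → adj G u w Bool.≟ true) ws) ≡ countB ws (adj G u)
    go []       = refl
    go (w ∷ ws) with adj G u w
    ... | true  = cong suc (go ws)
    ... | false = go ws

  -- Endpoints of walks, possibly repeated: only completeness and an upper bound on the length
  -- matter.
  ball : ℕ → Fin (size G) → List (Fin (size G))
  ball zero    u = u ∷ []
  ball (suc r) u = u ∷ concatMap (ball r) (neighbours u)

  near⇒∈ball : ∀ {r u v} → Near r u v → v ∈ ball r u
  near⇒∈ball {zero}  here       = here refl
  near⇒∈ball {suc r} here       = here refl
  near⇒∈ball {suc r} (step {v = v} e p) = there (∈ₚ.∈-concatMap⁺ (ball r)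
    (lose (∈ₚ.∈-filter⁺ (λ w → adj G _ w Bool.≟ true) (∈ₚ.∈-allFin v) e) (near⇒∈ball p)))

ballBound : ℕ → ℕ → ℕ
ballBound d zero    = 1
ballBound d (suc r) = suc (d * ballBound d r)

-- Bounds the distance from label zero to any label in use. In a node this walk goes from label zero
-- to the root and from the root to the target; `suc` leaves room for a direct edge when `reach t`
-- is 0. Adding `reach u` serves as a crude maximum.
reach : Term c n → ℕ
reach one            = 0
reach (node a S t u) = (suc (reach t) + suc (reach t)) + reach u

valBound : ℕ → Term c n → ℕ
valBound d one            = 1
valBound d (node a S t u) = ballBound d (suc (reach t)) * valBound d t * valBound d u

length-concatMap : ∀ (f : X → List Y) xs → length (concatMap f xs) ≡ ∑ xs (length ∘ f)
length-concatMap f []       = refl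
length-concatMap f (x ∷ xs) = ≡.trans (Listₚ.length-++ (f x)) (cong (length (f x) +_) (length-concatMap f xs))

-- Since `l` may repeat entries, each `f v` is spread over all its occurrences in `l`; exchanging
-- the sums can then only overcount, and no duplicates need removing.
∑-supported : ∀ (f : Fin n → ℕ) l k → (∀ v → f v ≢ 0 → v ∈ l) → (∀ v → f v ≤ k) →
  ∑ (allFin n) f ≤ length l * k
∑-supported {n} f l k supp f≤k = begin
  ∑ (allFin n) f                                             ≤⟨ ∑-mono (allFin n) spread ⟩
  ∑ (allFin n) (λ v → ∑ l (λ u → f v * b2n (eqFin v u)))     ≡⟨ ∑-swap (allFin n) l _ ⟩
  ∑ l (λ u → ∑ (allFin n) (λ v → f v * b2n (eqFin v u)))     ≡⟨ ∑-cong l (∑-dirac f) ⟩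
  ∑ l f                                                      ≤⟨ ∑-≤-length l k f≤k ⟩
  length l * k                                               ∎
  where
  open ℕₚ.≤-Reasoning
  spread : ∀ v → f v ≤ ∑ l (λ u → f v * b2n (eqFin v u))
  spread v with f v ≟ 0
  ... | yes z = subst (_≤ ∑ l (λ u → f v * b2n (eqFin v u))) (≡.sym z) z≤n
  ... | no nz = subst (_≤ ∑ l (λ u → f v * b2n (eqFin v u)))
    (≡.trans (cong (λ b → f v * b2n b) (eqFin-refl v)) (ℕₚ.*-identityʳ (f v)))
    (∑-∈ (λ u → f v * b2n (eqFin v u)) (supp v nz))

module _ (G : Graph c) {d : ℕ} (deg : MaxDegree≤ G d) where

  length-ball : ∀ r u → length (ball G r u) ≤ ballBound d r
  length-ball zero    u = ℕₚ.≤-refl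
  length-ball (suc r) u = s≤s (begin
    length (concatMap (ball G r) (neighbours G u))   ≡⟨ length-concatMap (ball G r) (neighbours G u) ⟩
    ∑ (neighbours G u) (length ∘ ball G r)           ≤⟨ ∑-≤-length (neighbours G u) (ballBound d r) (length-ball r) ⟩
    length (neighbours G u) * ballBound d r          ≤⟨ ℕₚ.*-monoˡ-≤ (ballBound d r) (ℕₚ.≤-trans (ℕₚ.≤-reflexive (length-neighbours G u)) (deg u)) ⟩
    d * ballBound d r                                ∎)
    where open ℕₚ.≤-Reasoning

  -- A nonzero value supplies an image for the root with a nonzero summand. Its edges to the labels,
  -- and inductively those below it, form the required walk.
  near-linked : ∀ {t : Term c (suc n)} ρ {i} → Linked t → val G t ρ ≢ 0 → Uses i t →
    Near G (reach t) (ρ zero) (ρ i)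
  near-attached : ∀ {t : Term c (suc n)} a S ρ v {i} → Linked t →
    b2n (fits G a S ρ v) * val G t (consF v ρ) ≢ 0 → Attached i S t → Near G (suc (reach t)) v (ρ i)
  near-linked {t = node a S t u} ρ {i} (node z l k) nz p with *-≢0 {b = val G u ρ} nz
  ... | nz₁ , nz₂ with ∑-≢0 (allFin (size G)) nz₁
  ...   | v , _ , nzᵥ = case p
    where
    via : Attached i S t → Near G (reach (node a S t u)) (ρ zero) (ρ i)
    via q = near-mono G (ℕₚ.m≤m+n _ (reach u))
      (near-trans G (near-sym G (near-attached a S ρ v l nzᵥ z)) (near-attached a S ρ v l nzᵥ q))
    case : Uses i (node a S t u) → Near G (reach (node a S t u)) (ρ zero) (ρ i)
    case (adjacent q) = via (inj₁ q)
    case (below q)    = via (inj₂ q)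
    case (beside q)   = near-mono G (ℕₚ.m≤n+m (reach u) _) (near-linked ρ k nz₂ q)
  near-attached {t = t} a S ρ v {i} l nz (inj₁ q) = near-mono G (s≤s z≤n)
    (step {r = 0} (≡.trans (sym G v (ρ i)) (allB⁻ {p = λ i → adj G (ρ i) v} (proj₂ (∧-true {eqFin a (col G v)} (b2n≢0 (proj₁ (*-≢0 {b = val G t (consF v ρ)} nz))))) q)) here)
  near-attached {t = t} a S ρ v l nz (inj₂ q) = near-mono G (ℕₚ.n≤1+n (reach t)) (near-linked (consF v ρ) l (proj₂ (*-≢0 {b2n (fits G a S ρ v)} nz)) q)

  -- By `near-attached`, only root images in a ball around a label of attachment contribute, and
  -- each contribution is bounded by induction.
  val≤valBound : ∀ {t : Term c (suc n)} → Linked t → ∀ ρ → val G t ρ ≤ valBound d t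
  branch≤ : ∀ {t : Term c (suc n)} {a S i} → Linked t → Attached i S t → ∀ ρ →
    ∑ (allFin (size G)) (λ v → b2n (fits G a S ρ v) * val G t (consF v ρ)) ≤ ballBound d (suc (reach t)) * valBound d t
  val≤valBound one          ρ = ℕₚ.≤-refl
  val≤valBound (node {a = a} z l k) ρ = ℕₚ.*-mono-≤ (branch≤ {a = a} l z ρ) (val≤valBound k ρ)
  branch≤ {t = t} {a} {S} {i} l z ρ = ℕₚ.≤-trans
    (∑-supported (λ v → b2n (fits G a S ρ v) * val G t (consF v ρ)) (ball G (suc (reach t)) (ρ i)) (valBound d t)
      (λ v nz → near⇒∈ball G (near-sym G (near-attached a S ρ v l nz z)))
      (λ v → ℕₚ.≤-trans (ℕₚ.*-monoˡ-≤ (val G t (consF v ρ)) (b2n≤1 (fits G a S ρ v)))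
               (ℕₚ.≤-trans (ℕₚ.≤-reflexive (ℕₚ.*-identityˡ _)) (val≤valBound l (consF v ρ)))))
    (ℕₚ.*-monoˡ-≤ (valBound d t) (length-ball (suc (reach t)) (ρ i)))

-- The finite set of patterns demanded by one round.

Branch : ℕ → ℕ → Set
Branch c n = Fin c × List (Fin n) × Term c (suc n)

tree : Branch c n → Term c n
tree (a , S , t) = node a S t one

data Factor (c n : ℕ) : Set where
  edge   : Fin n → Factor c n
  branch : Branch c (suc n) → Factor c n

-- A branch lacking only its root colour: the list holds the edges from the future root to older
-- labels, the term what hangs below it. Multiplying values means adding an edge or juxtaposing a
-- tree.
Monomial : ℕ → ℕ → Set
Monomial c n = List (Fin n) × Term c (suc n)

mul : Factor c n → Monomial c n → Monomial c n
mul (edge i)               (S , t) = i ∷ S , t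
mul (branch (a , S' , u)) (S , t) = S , node a S' u t

mulPow : Factor c n → ℕ → Monomial c n → Monomial c n
mulPow f zero    m = m
mulPow f (suc e) m = mul f (mulPow f e m)

-- Strict bounds, as `Statistic` requires: 2 for an indicator, a successor for a branch. The final
-- `* 1` is the value of the empty sibling forest in `tree`.
factorBound : ℕ → Factor c n → ℕ
factorBound d (edge i)               = 2
factorBound d (branch (a , S , t)) = suc (ballBound d (suc (reach t)) * valBound d t * 1)

-- Exponents run up to `factorBound` inclusive, exactly the range occurring in `Moments`.
monomials : ℕ → List (Factor c n) → List (Monomial c n)
monomials d []       = ([] , one) ∷ []
monomials d (f ∷ fs) = concatMap (λ e → map (mulPow f e) (monomials d fs)) (upTo (suc (factorBound d f)))

renameBranch : (Fin m → Maybe (Fin n)) → Branch c m → Branch c n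
renameBranch θ (a , S , t) = a , mapMaybe θ S , rename (lift θ) t

instantiate : Maybe (Fin n) → Fin (suc n) → Maybe (Fin n)
instantiate o zero    = o
instantiate o (suc i) = just i

usesNewest? : (b : Branch c (suc n)) → Dec (Attached zero (proj₁ (proj₂ b)) (proj₂ (proj₂ b)))
usesNewest? (a , S , t) = attached? zero S t

-- Only the patterns connected to the newest label vary with its position in a bounded way.
factors : List (Branch c (suc n)) → List (Factor c n)
factors K = map edge (allFin _) ++ map branch (filter usesNewest? K)

-- Dropping the newest label serves the patterns that do not use it; identifying it with an
-- older label serves the case in which the new vertex equals an old one.
instances : List (Branch c (suc n)) → List (Branch c n)
instances K = concatMap (λ o → map (renameBranch (instantiate o)) K) (nothing ∷ map just (allFin _))

roots : ℕ → List (Branch c (suc n)) → List (Branch c n)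
roots d K = concatMap (λ a → map (a ,_) (monomials d (factors K))) (allFin _)

demand : ℕ → List (Branch c (suc n)) → List (Branch c n)
demand d K = instances K ++ roots d K

mulPow-∈ : ∀ d (f : Factor c n) {fs e m} → e ≤ factorBound d f → m ∈ monomials d fs →
  mulPow f e m ∈ monomials d (f ∷ fs)
mulPow-∈ d f {fs} {e} le p = ∈ₚ.∈-concatMap⁺ (λ e → map (mulPow f e) (monomials d fs))
  (lose (∈ₚ.∈-upTo⁺ (s≤s le)) (∈ₚ.∈-map⁺ (mulPow f e) p))

∈-instances : ∀ o {b : Branch c (suc n)} {K} → b ∈ K → renameBranch (instantiate o) b ∈ instances K
∈-instances o {b} {K} p = ∈ₚ.∈-concatMap⁺ (λ o → map (renameBranch (instantiate o)) K)
  (lose (∈-options o) (∈ₚ.∈-map⁺ (renameBranch (instantiate o)) p))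
  where
  ∈-options : ∀ o → o ∈ nothing ∷ map just (allFin _)
  ∈-options nothing  = here refl
  ∈-options (just i) = there (∈ₚ.∈-map⁺ just (∈ₚ.∈-allFin i))

∈-roots : ∀ d (a : Fin c) {K : List (Branch c (suc n))} {m} →
  m ∈ monomials d (factors K) → (a , m) ∈ roots d K
∈-roots d a {K} p = ∈ₚ.∈-concatMap⁺ (λ a → map (a ,_) (monomials d (factors K)))
  (lose (∈ₚ.∈-allFin a) (∈ₚ.∈-map⁺ (a ,_) p))

-- Only the body is linked, namely to the root of the branch. The root itself may be connected to no
-- label; whether it reaches the newest one is decided by `usesNewest?`.
LinkedUpTo : ℕ → Branch c n → Set
LinkedUpTo r (a , S , t) = Linked t × suc (depth t) ≤ r

LinkedFactor : ℕ → Factor c n → Set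
LinkedFactor r (edge i)             = ⊤
LinkedFactor r (branch (a , S , t)) = Attached zero S t × LinkedUpTo r (a , S , t)

LinkedMonomial : ℕ → Monomial c n → Set
LinkedMonomial r (S , t) = Linked t × depth t ≤ r

All-concatMap⁺ : ∀ {P : Y → Set} (f : X → List Y) xs → (∀ x → All P (f x)) → All P (concatMap f xs)
All-concatMap⁺ f []       h = []
All-concatMap⁺ f (x ∷ xs) h = Allₚ.++⁺ (h x) (All-concatMap⁺ f xs h)

factors-linked : ∀ {r} {K : List (Branch c (suc n))} → All (LinkedUpTo r) K → All (LinkedFactor r) (factors K)
factors-linked {K = K} lk = Allₚ.++⁺ (Allₚ.map⁺ (All.universal (λ _ → tt) (allFin _)))
  (Allₚ.map⁺ (All.tabulate λ p → let p₁ , p₂ = ∈ₚ.∈-filter⁻ usesNewest? {xs = K} p in p₂ , All.lookup lk p₁))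

monomials-linked : ∀ {r} d {fs : List (Factor c n)} → All (LinkedFactor r) fs →
  All (LinkedMonomial r) (monomials d fs)
monomials-linked d []        = (one , z≤n) ∷ []
monomials-linked {r = r} d {f ∷ fs} (l ∷ ls) = All-concatMap⁺ (λ e → map (mulPow f e) (monomials d fs)) (upTo (suc (factorBound d f)))
  λ e → Allₚ.map⁺ (All.map (pow e) (monomials-linked d ls))
  where
  mul-linked : ∀ f {m} → LinkedFactor r f → LinkedMonomial r m → LinkedMonomial r (mul f m)
  mul-linked (edge i)   _             lm       = lm
  mul-linked (branch _) (z , l , le) (k , le') = node z l k , ℕₚ.⊔-lub le le'
  pow : ∀ e {m} → LinkedMonomial r m → LinkedMonomial r (mulPow f e m)
  pow zero    lm = lm
  pow (suc e) lm = mul-linked f l (pow e lm)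

-- Each branch factor is attached to the newest label, which becomes the root, so bodies built from
-- factors are linked. Instances keep the depth; new roots raise it by one.
demand-linked : ∀ {r} d {K : List (Branch c (suc n))} → All (LinkedUpTo r) K →
  All (LinkedUpTo (suc r)) (demand d K)
demand-linked {r = r} d {K} lk = Allₚ.++⁺
  (All-concatMap⁺ (λ o → map (renameBranch (instantiate o)) K) (nothing ∷ map just (allFin _))
    λ o → Allₚ.map⁺ (All.map (λ {b} → renamed o b) lk))
  (All-concatMap⁺ (λ a → map (a ,_) (monomials d (factors K))) (allFin _)
    λ a → Allₚ.map⁺ (All.map (λ { (l , le) → l , s≤s le }) (monomials-linked d (factors-linked lk))))
  where
  renamed : ∀ o b → LinkedUpTo r b → LinkedUpTo (suc r) (renameBranch (instantiate o) b)
  renamed o (a , S , t) (l , le) =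
    linked-rename refl l , ℕₚ.m≤n⇒m≤1+n (subst (λ k → suc k ≤ r) (≡.sym (depth-rename (lift (instantiate o)) t)) le)

-- Similar positions and one round of the game.

record SameAtoms (G G' : Graph c) (ρ : Fin n → Fin (size G)) (ρ' : Fin n → Fin (size G')) : Set where
  field
    same-eq  : ∀ i j → eqFin (ρ i) (ρ j) ≡ eqFin (ρ' i) (ρ' j)
    same-adj : ∀ i j → adj G (ρ i) (ρ j) ≡ adj G' (ρ' i) (ρ' j)
    same-col : ∀ i → col G (ρ i) ≡ col G' (ρ' i)
open SameAtoms

Similar : (G G' : Graph c) → List (Branch c n) → (Fin n → Fin (size G)) → (Fin n → Fin (size G')) → Set
Similar G G' K ρ ρ' = SameAtoms G G' ρ ρ' × All (λ b → val G (tree b) ρ ≡ val G' (tree b) ρ') K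

module _ (G : Graph c) (ρ : Fin n → Fin (size G)) where

  factorVal : Factor c n → Fin (size G) → ℕ
  factorVal (edge i)   v = b2n (adj G (ρ i) v)
  factorVal (branch b) v = val G (tree b) (consF v ρ)

  monomialVal : Monomial c n → Fin (size G) → ℕ
  monomialVal (S , t) v = b2n (allB S (λ i → adj G (ρ i) v)) * val G t (consF v ρ)

  mul-val : ∀ f m v → monomialVal (mul f m) v ≡ factorVal f v * monomialVal m v
  mul-val (edge i) (S , t) v =
    ≡.trans (cong (_* val G t (consF v ρ)) (b2n-∧ (adj G (ρ i) v) _)) (ℕₚ.*-assoc (b2n (adj G (ρ i) v)) _ _)
  mul-val (branch b@(a , S' , u)) (S , t) v = lemma (b2n (allB S (λ i → adj G (ρ i) v)))
    (∑ (allFin (size G)) (λ x → b2n (fits G a S' (consF v ρ) x) * val G u (consF x (consF v ρ)))) (val G t (consF v ρ))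
    where
    lemma : ∀ x y z → x * (y * z) ≡ (y * 1) * (x * z)
    lemma = solve-∀

  mulPow-val : ∀ f e m v → monomialVal (mulPow f e m) v ≡ factorVal f v ^ e * monomialVal m v
  mulPow-val f zero    m v = ≡.sym (ℕₚ.*-identityˡ _)
  mulPow-val f (suc e) m v = ≡.trans (mul-val f (mulPow f e m) v)
    (≡.trans (cong (factorVal f v *_) (mulPow-val f e m v)) (≡.sym (ℕₚ.*-assoc (factorVal f v) _ _)))

  root-val : ∀ a m → val G (tree (a , m)) ρ ≡
    ∑ (allFin (size G)) (λ v → b2n (eqFin a (col G v)) * monomialVal m v)
  root-val a (S , t) = ≡.trans (ℕₚ.*-identityʳ _) (∑-cong (allFin (size G)) λ v →
    ≡.trans (cong (_* val G t (consF v ρ)) (b2n-∧ (eqFin a (col G v)) _)) (ℕₚ.*-assoc (b2n (eqFin a (col G v))) _ _))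

  factor< : ∀ {d r} → MaxDegree≤ G d → ∀ f → LinkedFactor r f → ∀ v → factorVal f v < factorBound d f
  factor< deg (edge i)             _           v = s≤s (b2n≤1 (adj G (ρ i) v))
  factor< deg (branch (a , S , t)) (z , l , _) v = s≤s (ℕₚ.*-monoˡ-≤ 1 (branch≤ G deg {a = a} l z (consF v ρ)))

  instance-val : ∀ o (b : Branch c (suc n)) v → (∀ i → o ≡ just i → v ≡ ρ i) →
    (o ≡ nothing → ¬ Uses zero (tree b)) → val G (tree (renameBranch (instantiate o) b)) ρ ≡ val G (tree b) (consF v ρ)
  instance-val o b v h h' = val-rename G (tree b) (compatible o h h')
    where
    compatible : ∀ o → (∀ i → o ≡ just i → v ≡ ρ i) → (o ≡ nothing → ¬ Uses zero (tree b)) →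
      ∀ i → Uses i (tree b) → ∃ λ i' → instantiate o i ≡ just i' × ρ i' ≡ consF v ρ i
    compatible o        h h' (suc i) p = i , refl , refl
    compatible (just i) h h' zero    p = i , refl , ≡.sym (h i refl)
    compatible nothing  h h' zero    p = ⊥-elim (h' refl p)

module _ (G G' : Graph c) {d : ℕ} (deg : MaxDegree≤ G d) (deg' : MaxDegree≤ G' d)
  (ρ : Fin n → Fin (size G)) (ρ' : Fin n → Fin (size G')) where

  open Interpolation (allFin (size G)) (allFin (size G'))

  private
    Stat = Statistic (Fin (size G)) (Fin (size G'))

  factorStatistics : ∀ {r} fs → All (LinkedFactor r) fs → List Stat
  factorStatistics []       []       = []
  factorStatistics (f ∷ fs) (l ∷ ls) = record
    { left   = factorVal G ρ f
    ; right  = factorVal G' ρ' f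
    ; bound  = factorBound d f
    ; left<  = factor< G ρ deg f l
    ; right< = factor< G' ρ' deg' f l
    } ∷ factorStatistics fs ls

  -- This indicator is not the value of a pattern; its moments come from `moments-equalities`.
  equalityStatistic : Fin n → Stat
  equalityStatistic i = record
    { left   = λ v → b2n (eqFin v (ρ i))
    ; right  = λ v → b2n (eqFin v (ρ' i))
    ; bound  = 2
    ; left<  = λ v → s≤s (b2n≤1 (eqFin v (ρ i)))
    ; right< = λ v → s≤s (b2n≤1 (eqFin v (ρ' i)))
    }

  agree-factors⁻ : ∀ {r fs} (ls : All (LinkedFactor r) fs) {v v'} → Agree (factorStatistics fs ls) v v' →
    All (λ f → factorVal G ρ f v ≡ factorVal G' ρ' f v') fs
  agree-factors⁻ []       []       = []
  agree-factors⁻ (l ∷ ls) (e ∷ es) = e ∷ agree-factors⁻ ls es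

  agree-factors⁺ : ∀ {r fs} (ls : All (LinkedFactor r) fs) {v v'} →
    All (λ f → factorVal G ρ f v ≡ factorVal G' ρ' f v') fs → Agree (factorStatistics fs ls) v v'
  agree-factors⁺ []       []       = []
  agree-factors⁺ (l ∷ ls) (e ∷ es) = e ∷ agree-factors⁺ ls es

  moments-factors : ∀ {r} fs (ls : All (LinkedFactor r) fs) {w w'} →
    (∀ {m} → m ∈ monomials d fs →
      ∑ (allFin (size G)) (λ v → w v * monomialVal G ρ m v) ≡
      ∑ (allFin (size G')) (λ v → w' v * monomialVal G' ρ' m v)) →
    Moments (factorStatistics fs ls) w w'
  moments-factors []       []       {w} {w'} h =
    ≡.trans (∑-cong (allFin (size G)) (λ v → ≡.sym (ℕₚ.*-identityʳ (w v))))
      (≡.trans (h (here refl)) (∑-cong (allFin (size G')) (λ v → ℕₚ.*-identityʳ (w' v))))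
  moments-factors (f ∷ fs) (l ∷ ls) {w} {w'} h e le = moments-factors fs ls λ {m} p →
    ≡.trans (∑-cong (allFin (size G)) (absorb G ρ w m))
      (≡.trans (h (mulPow-∈ d f {fs} le p)) (≡.sym (∑-cong (allFin (size G')) (absorb G' ρ' w' m))))
    where
    absorb : ∀ (G : Graph c) ρ (w : Fin (size G) → ℕ) m v →
      w v * factorVal G ρ f v ^ e * monomialVal G ρ m v ≡ w v * monomialVal G ρ (mulPow f e m) v
    absorb G ρ w m v = ≡.trans (ℕₚ.*-assoc (w v) _ _) (cong (w v *_) (≡.sym (mulPow-val G ρ f e m v)))

  -- When the weight is concentrated at one vertex, a moment is a single product evaluated there, so
  -- agreement at that vertex suffices.
  moments-point : ∀ ss {w : Fin (size G) → ℕ} {w' : Fin (size G') → ℕ} {u u'} → Agree ss u u' → w u ≡ w' u' →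
    Moments ss (λ v → w v * b2n (eqFin v u)) (λ v → w' v * b2n (eqFin v u'))
  moments-point []       {w} {w'} {u} {u'} _ e = ≡.trans (∑-dirac w u) (≡.trans e (≡.sym (∑-dirac w' u')))
  moments-point (s ∷ ss) {w} {w'} {u} {u'} (e ∷ es) q k le =
    Moments-cong ss (λ v → *-right-comm (w v) _ _) (λ v → *-right-comm (w' v) _ _)
      (moments-point ss {λ v → w v * left s v ^ k} {λ v → w' v * right s v ^ k} es (cong₂ (λ x y → x * y ^ k) q e))

  -- Exponent 0 ignores the statistic. Any positive power of an indicator is the indicator itself,
  -- which concentrates the weight at `ρ i`, where all statistics agree by hypothesis.
  moments-equalities : ∀ is ss {w : Fin (size G) → ℕ} {w' : Fin (size G') → ℕ} →
    (∀ i → Agree (map equalityStatistic is ++ ss) (ρ i) (ρ' i)) → (∀ i → w (ρ i) ≡ w' (ρ' i)) →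
    Moments ss w w' → Moments (map equalityStatistic is ++ ss) w w'
  moments-equalities []       ss h q m = m
  moments-equalities (i ∷ is) ss {w} {w'} h q m zero _ = Moments-cong (map equalityStatistic is ++ ss)
    (λ v → ≡.sym (ℕₚ.*-identityʳ (w v))) (λ v → ≡.sym (ℕₚ.*-identityʳ (w' v)))
    (moments-equalities is ss (All.tail ∘ h) q m)
  moments-equalities (i ∷ is) ss {w} {w'} h q m (suc e) _ = Moments-cong (map equalityStatistic is ++ ss)
    (λ v → cong (w v *_) (idempotent (eqFin v (ρ i)))) (λ v → cong (w' v *_) (idempotent (eqFin v (ρ' i))))
    (moments-point (map equalityStatistic is ++ ss) {w} {w'} (All.tail (h i)) (q i))
    where
    idempotent : ∀ b → b2n b ≡ b2n b ^ suc e
    idempotent true  = ≡.sym (≡.trans (ℕₚ.*-identityˡ _) (ℕₚ.^-zeroˡ e))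
    idempotent false = refl

  sameAtoms-cons : SameAtoms G G' ρ ρ' → ∀ {v v'} →
    (∀ i → eqFin v (ρ i) ≡ eqFin v' (ρ' i)) → (∀ i → adj G (ρ i) v ≡ adj G' (ρ' i) v') → col G v ≡ col G' v' →
    SameAtoms G G' (consF v ρ) (consF v' ρ')
  sameAtoms-cons sa {v} {v'} e a k = record { same-eq = eqs ; same-adj = adjs ; same-col = cols }
    where
    eqFin-sym : ∀ {n} (i j : Fin n) → eqFin i j ≡ eqFin j i
    eqFin-sym i j = bool-ext (λ p → subst (λ k → eqFin k i ≡ true) (eqFin⇒≡ p) (eqFin-refl i))
                             (λ p → subst (λ k → eqFin k j ≡ true) (eqFin⇒≡ p) (eqFin-refl j))
    eqs : ∀ i j → eqFin (consF v ρ i) (consF v ρ j) ≡ eqFin (consF v' ρ' i) (consF v' ρ' j)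
    eqs zero    zero    = ≡.trans (eqFin-refl v) (≡.sym (eqFin-refl v'))
    eqs zero    (suc j) = e j
    eqs (suc i) zero    = ≡.trans (eqFin-sym (ρ i) v) (≡.trans (e i) (eqFin-sym v' (ρ' i)))
    eqs (suc i) (suc j) = same-eq sa i j
    adjs : ∀ i j → adj G (consF v ρ i) (consF v ρ j) ≡ adj G' (consF v' ρ' i) (consF v' ρ' j)
    adjs zero    zero    = ≡.trans (irrefl G v) (≡.sym (irrefl G' v'))
    adjs zero    (suc j) = ≡.trans (sym G v (ρ j)) (≡.trans (a j) (sym G' (ρ' j) v'))
    adjs (suc i) zero    = a i
    adjs (suc i) (suc j) = same-adj sa i j
    cols : ∀ i → col G (consF v ρ i) ≡ col G' (consF v' ρ' i)
    cols zero    = k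
    cols (suc i) = same-col sa i

  -- Duplicator's bijection is never built: a counting quantifier only needs equal numbers of
  -- witnesses. These follow by interpolation, because colour and statistics determine the extended
  -- position up to similarity.
  similar⇒count : ∀ {r K} → All (LinkedUpTo r) K → Similar G G' (demand d K) ρ ρ' →
    ∀ (P : Fin (size G) → Bool) (P' : Fin (size G') → Bool) →
    (∀ v v' → Similar G G' K (consF v ρ) (consF v' ρ') → P v ≡ P' v') →
    countB (allFin (size G)) P ≡ countB (allFin (size G')) P'
  similar⇒count {r} {K} lk (sa , vals) P P' h = begin
    countB (allFin (size G)) P           ≡⟨ split G P ⟩
    ∑ (allFin c) (λ a → ∑ (allFin (size G)) (λ v → b2n (eqFin a (col G v)) * b2n (P v)))
      ≡⟨ ∑-cong (allFin c) (λ a → moments⇒count statistics (moments a) P P' (transfer a)) ⟩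
    ∑ (allFin c) (λ a → ∑ (allFin (size G')) (λ v → b2n (eqFin a (col G' v)) * b2n (P' v)))
      ≡⟨ split G' P' ⟨
    countB (allFin (size G')) P'         ∎
    where
    open ≡-Reasoning
    -- Each vertex is counted in exactly one colour class, matching roots of prescribed colour.
    split : ∀ (G : Graph c) P → countB (allFin (size G)) P ≡
      ∑ (allFin c) (λ a → ∑ (allFin (size G)) (λ v → b2n (eqFin a (col G v)) * b2n (P v)))
    split G P = ≡.trans (countB≡∑ (allFin (size G)) P)
      (≡.trans (∑-cong (allFin (size G)) λ v → ≡.sym (≡.trans
                 (∑-cong (allFin c) (λ a → ℕₚ.*-comm (b2n (eqFin a (col G v))) _))
                 (∑-dirac (λ _ → b2n (P v)) (col G v))))
               (∑-swap (allFin (size G)) (allFin c) _))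
    ls = factors-linked {K = K} lk
    statistics = map equalityStatistic (allFin n) ++ factorStatistics (factors K) ls

    instance-≡ : ∀ o {b} → b ∈ K → val G (tree (renameBranch (instantiate o) b)) ρ ≡ val G' (tree (renameBranch (instantiate o) b)) ρ'
    instance-≡ o p = All.lookup vals (∈ₚ.∈-++⁺ˡ (∈-instances o p))

    -- Identifying the newest label with label i turns a branch factor at `ρ i` into a demanded
    -- pattern; edge factors there are atoms of the old position.
    at-label : ∀ i f → f ∈ factors K → factorVal G ρ f (ρ i) ≡ factorVal G' ρ' f (ρ' i)
    at-label i (edge j)   p = cong b2n (same-adj sa j i)
    at-label i (branch b) p with ∈ₚ.∈-++⁻ (map edge (allFin n)) p
    ... | inj₁ q with ∈ₚ.∈-map⁻ edge q
    ...   | _ , _ , ()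
    at-label i (branch b) p | inj₂ q with ∈ₚ.∈-map⁻ branch q
    ...   | _ , q' , refl = ≡.trans (≡.sym (instance-val G ρ (just i) b (ρ i) (λ { _ refl → refl }) λ ()))
      (≡.trans (instance-≡ (just i) (proj₁ (∈ₚ.∈-filter⁻ usesNewest? {xs = K} q')))
               (instance-val G' ρ' (just i) b (ρ' i) (λ { _ refl → refl }) λ ()))

    moments : ∀ a → Moments statistics (λ v → b2n (eqFin a (col G v))) (λ v → b2n (eqFin a (col G' v)))
    moments a = moments-equalities (allFin n) (factorStatistics (factors K) ls)
      (λ i → Allₚ.++⁺ (Allₚ.map⁺ (All.universal (λ j → cong b2n (same-eq sa i j)) (allFin n)))
                      (agree-factors⁺ ls (All.tabulate λ {f} p → at-label i f p)))
      (λ i → cong (b2n ∘ eqFin a) (same-col sa i))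
      (moments-factors (factors K) ls λ {m} p → ≡.trans (≡.sym (root-val G ρ a m))
        (≡.trans (All.lookup vals (∈ₚ.∈-++⁺ʳ (instances K) (∈-roots d a {K} p))) (root-val G' ρ' a m)))

    transfer : ∀ a v v' → b2n (eqFin a (col G v)) ≢ 0 → b2n (eqFin a (col G' v')) ≢ 0 →
      Agree statistics v v' → P v ≡ P' v'
    transfer a v v' p p' ag = h v v'
      ( sameAtoms-cons sa
          (λ i → b2n-injective (All.lookup (Allₚ.map⁻ (Allₚ.++⁻ˡ (map equalityStatistic (allFin n)) ag)) (∈ₚ.∈-allFin i)))
          (λ i → b2n-injective (All.lookup ag-factors (∈ₚ.∈-++⁺ˡ (∈ₚ.∈-map⁺ edge (∈ₚ.∈-allFin i)))))
          (≡.trans (≡.sym (eqFin⇒≡ (b2n≢0 p))) (eqFin⇒≡ (b2n≢0 p')))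
      , All.tabulate λ {b} → value b )
      where
      ag-factors = agree-factors⁻ ls (Allₚ.++⁻ʳ (map equalityStatistic (allFin n)) ag)
      value : ∀ b → b ∈ K → val G (tree b) (consF v ρ) ≡ val G' (tree b) (consF v' ρ')
      value b@(_ , S , t) p with usesNewest? b
      ... | yes q = All.lookup ag-factors (∈ₚ.∈-++⁺ʳ (map edge (allFin n)) (∈ₚ.∈-map⁺ branch (∈ₚ.∈-filter⁺ usesNewest? p q)))
      -- A branch avoiding the newest label has a value fixed before that vertex is chosen, possibly
      -- unbounded but already among the demanded instances.
      ... | no ¬q = ≡.trans (≡.sym (instance-val G ρ nothing b v (λ _ ()) (λ _ → unused)))
        (≡.trans (instance-≡ nothing p) (instance-val G' ρ' nothing b v' (λ _ ()) (λ _ → unused)))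
        where
        unused : ¬ Uses zero (tree b)
        unused (adjacent i) = ¬q (inj₁ i)
        unused (below u)    = ¬q (inj₂ u)

-- The game with r rounds left.

-- With no round left only atoms are compared, hence the empty list.
test-branches : ∀ {c} → ℕ → ℕ → ∀ n → List (Branch c n)
test-branches d zero    n = []
test-branches d (suc r) n = demand d (test-branches d r (suc n))

test-linked : ∀ d r n → All (LinkedUpTo {c} r) (test-branches d r n)
test-linked d zero    n = []
test-linked d (suc r) n = demand-linked d (test-linked d r (suc n))

module _ (G G' : Graph c) {d : ℕ} (deg : MaxDegree≤ G d) (deg' : MaxDegree≤ G' d) where

  similar⇒sat : ∀ r (φ : Formula c n) ρ ρ' → qr φ ≤ r → Similar G G' (test-branches d r n) ρ ρ' →
    sat G φ ρ ≡ sat G' φ ρ'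
  similar⇒sat r (eq x y)   ρ ρ' le (sa , _) = same-eq sa x y
  similar⇒sat r (edge x y) ρ ρ' le (sa , _) = same-adj sa x y
  similar⇒sat r (colr x a) ρ ρ' le (sa , _) = cong (λ b → eqFin b a) (same-col sa x)
  similar⇒sat r (neg φ)    ρ ρ' le s = cong not (similar⇒sat r φ ρ ρ' le s)
  similar⇒sat r (disj φ ψ) ρ ρ' le s = cong₂ _∨_
    (similar⇒sat r φ ρ ρ' (ℕₚ.m⊔n≤o⇒m≤o (qr φ) (qr ψ) le) s)
    (similar⇒sat r ψ ρ ρ' (ℕₚ.m⊔n≤o⇒n≤o (qr φ) (qr ψ) le) s)
  similar⇒sat (suc r) (∃≥ p φ) ρ ρ' (s≤s le) s = cong (λ k → ⌊ p ≤? k ⌋)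
    (similar⇒count G G' deg deg' ρ ρ' (test-linked d r _) s _ _
      (λ v v' s' → similar⇒sat r φ (consF v ρ) (consF v' ρ') le s'))

-- Terms as graphs with an elimination forest.

data Vertex {c : ℕ} : Term c n → Set where
  root    : ∀ {a} {S : List (Fin n)} {t u} → Vertex (node a S t u)
  child   : ∀ {a} {S : List (Fin n)} {t u} → Vertex t → Vertex (node a S t u)
  sibling : ∀ {a} {S : List (Fin n)} {t u} → Vertex u → Vertex (node a S t u)

colour : {t : Term c n} → Vertex t → Fin c
colour {t = node a S t u} root        = a
colour {t = node a S t u} (child x)   = colour x
colour {t = node a S t u} (sibling x) = colour x

-- Membership rather than multiplicity: labels repeated by powers of an edge factor yield one edge,
-- in accordance with `fits`.
labelAdj : {t : Term c n} → Fin n → Vertex t → Bool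
labelAdj {t = node a S t u} i root        = ⌊ i ∈? S ⌋
  where open import Data.List.Membership.DecPropositional Fin._≟_ using (_∈?_)
labelAdj {t = node a S t u} i (child x)   = labelAdj (suc i) x
labelAdj {t = node a S t u} i (sibling x) = labelAdj i x

vertexAdj : {t : Term c n} → Vertex t → Vertex t → Bool
vertexAdj root        (child y)   = labelAdj zero y
vertexAdj (child x)   root        = labelAdj zero x
vertexAdj (child x)   (child y)   = vertexAdj x y
vertexAdj (sibling x) (sibling y) = vertexAdj x y
vertexAdj _           _           = false

vertexAdj-sym : {t : Term c n} (x y : Vertex t) → vertexAdj x y ≡ vertexAdj y x
vertexAdj-sym root        root        = refl
vertexAdj-sym root        (child y)   = refl
vertexAdj-sym root        (sibling y) = refl
vertexAdj-sym (child x)   root        = refl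
vertexAdj-sym (child x)   (child y)   = vertexAdj-sym x y
vertexAdj-sym (child x)   (sibling y) = refl
vertexAdj-sym (sibling x) root        = refl
vertexAdj-sym (sibling x) (child y)   = refl
vertexAdj-sym (sibling x) (sibling y) = vertexAdj-sym x y

vertexAdj-irrefl : {t : Term c n} (x : Vertex t) → vertexAdj x x ≡ false
vertexAdj-irrefl root        = refl
vertexAdj-irrefl (child x)   = vertexAdj-irrefl x
vertexAdj-irrefl (sibling x) = vertexAdj-irrefl x

data _⊑_ {c : ℕ} : {t : Term c n} → Vertex t → Vertex t → Set where
  root⊑root  : ∀ {a} {S : List (Fin n)} {t u} → _⊑_ {t = node a S t u} root root
  root⊑child : ∀ {a} {S : List (Fin n)} {t u} {y : Vertex t} → _⊑_ {t = node a S t u} root (child y)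
  child      : ∀ {a} {S : List (Fin n)} {t u} {x y : Vertex t} → x ⊑ y → _⊑_ {t = node a S t u} (child x) (child y)
  sibling    : ∀ {a} {S : List (Fin n)} {t u} {x y : Vertex u} → x ⊑ y → _⊑_ {t = node a S t u} (sibling x) (sibling y)

⊑-refl : {t : Term c n} {x : Vertex t} → x ⊑ x
⊑-refl {x = root}      = root⊑root
⊑-refl {x = child x}   = child ⊑-refl
⊑-refl {x = sibling x} = sibling ⊑-refl

⊑-trans : {t : Term c n} {x y z : Vertex t} → x ⊑ y → y ⊑ z → x ⊑ z
⊑-trans root⊑root   q           = q
⊑-trans root⊑child  (child q)   = root⊑child
⊑-trans (child p)   (child q)   = child (⊑-trans p q)
⊑-trans (sibling p) (sibling q) = sibling (⊑-trans p q)

⊑-antisym : {t : Term c n} {x y : Vertex t} → x ⊑ y → y ⊑ x → x ≡ y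
⊑-antisym root⊑root   root⊑root   = refl
⊑-antisym (child p)   (child q)   = cong child (⊑-antisym p q)
⊑-antisym (sibling p) (sibling q) = cong sibling (⊑-antisym p q)

⊑-downChain : {t : Term c n} {x y z : Vertex t} → x ⊑ z → y ⊑ z → x ⊑ y ⊎ y ⊑ x
⊑-downChain root⊑root   root⊑root   = inj₁ root⊑root
⊑-downChain root⊑child  root⊑child  = inj₁ root⊑root
⊑-downChain root⊑child  (child q)   = inj₁ root⊑child
⊑-downChain (child p)   root⊑child  = inj₂ root⊑child
⊑-downChain (child p)   (child q)   = Sum.map child child (⊑-downChain p q)
⊑-downChain (sibling p) (sibling q) = Sum.map sibling sibling (⊑-downChain p q)

adjacent⇒comparable : {t : Term c n} (x y : Vertex t) → vertexAdj x y ≡ true → x ⊑ y ⊎ y ⊑ x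
adjacent⇒comparable root        (child y)   _ = inj₁ root⊑child
adjacent⇒comparable (child x)   root        _ = inj₂ root⊑child
adjacent⇒comparable (child x)   (child y)   e = Sum.map child child (adjacent⇒comparable x y e)
adjacent⇒comparable (sibling x) (sibling y) e = Sum.map sibling sibling (adjacent⇒comparable x y e)

level : {t : Term c n} → Vertex t → ℕ
level root        = 0
level (child x)   = suc (level x)
level (sibling x) = level x

level<depth : {t : Term c n} (x : Vertex t) → level x < depth t
level<depth {t = node a S t u} root        = ℕₚ.m≤n⇒m≤n⊔o (depth u) (s≤s z≤n)
level<depth {t = node a S t u} (child x)   = ℕₚ.m≤n⇒m≤n⊔o (depth u) (s≤s (level<depth x))
level<depth {t = node a S t u} (sibling x) = ℕₚ.m≤n⇒m≤o⊔n (suc (depth t)) (level<depth x)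

⊑-level : {t : Term c n} {x y : Vertex t} → x ⊑ y → level x ≡ level y → x ≡ y
⊑-level root⊑root   _ = refl
⊑-level (child p)   e = cong child (⊑-level p (ℕₚ.suc-injective e))
⊑-level (sibling p) e = cong sibling (⊑-level p e)

order : Term c n → ℕ
order one            = 0
order (node a S t u) = suc (order t + order u)

-- Preorder numbering: the root, then the block of `t`, then that of `u`. Maps out of the vertex set
-- thereby take the form `consF v (f ⧺ g)`.
index : {t : Term c n} → Vertex t → Fin (order t)
index root                                   = zero
index {t = node a S t u} (child x)           = suc (index x ↑ˡ order u)
index {t = node a S t u} (sibling x)         = suc (order t ↑ʳ index x)

vertex : (t : Term c n) → Fin (order t) → Vertex t
vertex (node a S t u) zero    = root
vertex (node a S t u) (suc i) = Sum.[ child ∘ vertex t , sibling ∘ vertex u ] (splitAt (order t) i)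

vertex-index : {t : Term c n} (x : Vertex t) → vertex t (index x) ≡ x
vertex-index root = refl
vertex-index {t = node a S t u} (child x)
  rewrite Finₚ.splitAt-↑ˡ (order t) (index x) (order u) = cong child (vertex-index x)
vertex-index {t = node a S t u} (sibling x)
  rewrite Finₚ.splitAt-↑ʳ (order t) (order u) (index x) = cong sibling (vertex-index x)

index-vertex : (t : Term c n) (i : Fin (order t)) → index (vertex t i) ≡ i
index-vertex (node a S t u) zero = refl
index-vertex (node a S t u) (suc i) with splitAt (order t) i in e
... | inj₁ j = cong suc (≡.trans (cong (_↑ˡ order u) (index-vertex t j)) (Finₚ.splitAt⁻¹-↑ˡ e))
... | inj₂ j = cong suc (≡.trans (cong (order t ↑ʳ_) (index-vertex u j)) (Finₚ.splitAt⁻¹-↑ʳ e))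

graph : Term c 0 → Graph c
graph t = record
  { size   = order t
  ; adj    = λ i j → vertexAdj (vertex t i) (vertex t j)
  ; sym    = λ i j → vertexAdj-sym (vertex t i) (vertex t j)
  ; irrefl = λ i → vertexAdj-irrefl (vertex t i)
  ; col    = λ i → colour (vertex t i)
  }

AllPairs-lookup : ∀ {R : X → X → Set} {xs} → AllPairs R xs → ∀ {i j} → i Fin.< j → R (lookup xs i) (lookup xs j)
AllPairs-lookup (r ∷ rs) {zero}  {suc j} _         = All.lookup r (∈ₚ.∈-lookup j)
AllPairs-lookup (r ∷ rs) {suc i} {suc j} (s≤s i<j) = AllPairs-lookup rs i<j

treeDepth-graph : (t : Term c 0) → TreeDepth≤ (graph t) (depth t)
treeDepth-graph t = forest , (λ i j → adjacent⇒comparable (vertex t i) (vertex t j)) , height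
  where
  vertex-injective : ∀ {i j} → vertex t i ≡ vertex t j → i ≡ j
  vertex-injective {i} {j} e = ≡.trans (≡.sym (index-vertex t i)) (≡.trans (cong index e) (index-vertex t j))
  forest : Forest (order t)
  forest = record
    { _≼_  = λ i j → vertex t i ⊑ vertex t j
    ; isPO = record
      { isPreorder = record
        { isEquivalence = ≡.isEquivalence
        ; reflexive     = λ { refl → ⊑-refl }
        ; trans         = ⊑-trans
        }
      ; antisym = λ p q → vertex-injective (⊑-antisym p q)
      }
    ; downChain = ⊑-downChain
    }
  height : Height≤ forest (depth t)
  height xs (unique , comparable) with length xs ≤? depth t
  ... | yes le = le
  -- A chain longer than the depth has two entries on one level; comparable vertices on one level
  -- coincide, against uniqueness.
  ... | no ¬le with Finₚ.pigeonhole (ℕₚ.≰⇒> ¬le) (λ i → Fin.fromℕ< (level<depth (vertex t (lookup xs i))))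
  ...   | i , j , i<j , e = ⊥-elim (AllPairs-lookup unique i<j (vertex-injective (equal (AllPairs-lookup comparable i<j))))
    where
    same-level = Finₚ.fromℕ<-injective _ _ (level<depth (vertex t (lookup xs i))) (level<depth (vertex t (lookup xs j))) e
    equal : Comparable forest (lookup xs i) (lookup xs j) → vertex t (lookup xs i) ≡ vertex t (lookup xs j)
    equal (inj₁ p) = ⊑-level p same-level
    equal (inj₂ p) = ≡.sym (⊑-level p (≡.sym same-level))

-- Homomorphism counts as nested sums.

module _ (G : Graph c) where

  private
    V = Fin (size G)

  -- The homomorphism condition arranged along the term: each edge is tested by `fits` at its deeper
  -- end, so that the indicator factors in the same way as `val`.
  respects : (t : Term c n) → (Fin n → V) → (Vertex t → V) → Bool
  respects one            ρ h = true
  respects (node a S t u) ρ h =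
    fits G a S ρ (h root) ∧ respects t (consF (h root) ρ) (h ∘ child) ∧ respects u ρ (h ∘ sibling)

  respects-cong : ∀ (t : Term c n) ρ {h h'} → h ≗ h' → respects t ρ h ≡ respects t ρ h'
  respects-cong one            ρ e = refl
  respects-cong (node a S t u) ρ {h} {h'} e rewrite e root =
    cong₂ (λ x y → fits G a S ρ (h' root) ∧ x ∧ y) (respects-cong t (consF (h' root) ρ) (e ∘ child)) (respects-cong u ρ (e ∘ sibling))

  record IsLabelledHom (t : Term c n) (ρ : Fin n → V) (h : Vertex t → V) : Set where
    field
      on-colours : ∀ x → eqFin (colour x) (col G (h x)) ≡ true
      on-labels  : ∀ i x → labelAdj i x ≡ true → adj G (ρ i) (h x) ≡ true
      on-edges   : ∀ x y → vertexAdj x y ≡ true → adj G (h x) (h y) ≡ true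
  open IsLabelledHom

  respects⇒hom : ∀ (t : Term c n) ρ h → respects t ρ h ≡ true → IsLabelledHom t ρ h
  respects⇒hom one            ρ h _ = record { on-colours = λ () ; on-labels = λ _ () ; on-edges = λ () }
  respects⇒hom (node a S t u) ρ h e with ∧-true {fits G a S ρ (h root)} e
  ... | e₁ , e₂ with ∧-true {eqFin a (col G (h root))} e₁ | ∧-true {respects t (consF (h root) ρ) (h ∘ child)} e₂
  ...   | k , s | et , eu = record { on-colours = colours ; on-labels = labels ; on-edges = edges }
    where
    open import Data.List.Membership.DecPropositional Fin._≟_ using (_∈?_)
    T = respects⇒hom t _ _ et
    U = respects⇒hom u _ _ eu
    colours : ∀ x → eqFin (colour x) (col G (h x)) ≡ true
    colours root        = k
    colours (child x)   = on-colours T x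
    colours (sibling x) = on-colours U x
    labels : ∀ i x → labelAdj i x ≡ true → adj G (ρ i) (h x) ≡ true
    labels i root        p = allB⁻ {p = λ i → adj G (ρ i) (h root)} s (true-dec (i ∈? S) p)
    labels i (child x)   p = on-labels T (suc i) x p
    labels i (sibling x) p = on-labels U i x p
    edges : ∀ x y → vertexAdj x y ≡ true → adj G (h x) (h y) ≡ true
    edges root        (child y)   p = on-labels T zero y p
    edges (child x)   root        p = ≡.trans (sym G _ _) (on-labels T zero x p)
    edges (child x)   (child y)   p = on-edges T x y p
    edges (sibling x) (sibling y) p = on-edges U x y p

  hom⇒respects : ∀ (t : Term c n) ρ h → IsLabelledHom t ρ h → respects t ρ h ≡ true
  hom⇒respects one            ρ h H = refl
  hom⇒respects (node a S t u) ρ h H = ∧-intro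
    (∧-intro (on-colours H root) (allB⁺ S λ i p → on-labels H i root (dec-true (i ∈? S) p)))
    (∧-intro
      (hom⇒respects t _ _ record
        { on-colours = on-colours H ∘ child
        -- Label zero of `t` is the root, so edges to it are edges inside the larger pattern.
        ; on-labels  = λ { zero x p → on-edges H root (child x) p ; (suc i) x p → on-labels H i (child x) p }
        ; on-edges   = λ x y → on-edges H (child x) (child y)
        })
      (hom⇒respects u _ _ record
        { on-colours = on-colours H ∘ sibling
        ; on-labels  = λ i x → on-labels H i (sibling x)
        ; on-edges   = λ x y → on-edges H (sibling x) (sibling y)
        }))
    where open import Data.List.Membership.DecPropositional Fin._≟_ using (_∈?_)

  isHom≡respects : ∀ (t : Term c 0) h ρ → isHom (graph t) G h ≡ respects t ρ (h ∘ index)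
  isHom≡respects t h ρ = bool-ext to from
    where
    to : isHom (graph t) G h ≡ true → respects t ρ (h ∘ index) ≡ true
    to e with ∧-true {allB (allFin (order t)) λ i → allB (allFin (order t)) λ j →
      not (vertexAdj (vertex t i) (vertex t j)) ∨ adj G (h i) (h j)} e
    ... | es , cs = hom⇒respects t ρ _ record
      { on-colours = λ x → subst (λ y → eqFin (colour y) (col G (h (index x))) ≡ true) (vertex-index x)
                             (allB⁻ {p = λ i → eqFin (colour (vertex t i)) (col G (h i))} cs (∈ₚ.∈-allFin (index x)))
      ; on-labels  = λ ()
      ; on-edges   = λ x y p → ⇒-elim
          (allB⁻ {p = λ j → not (vertexAdj (vertex t (index x)) (vertex t j)) ∨ adj G (h (index x)) (h j)}
            (allB⁻ {p = λ i → allB (allFin (order t)) (λ j → not (vertexAdj (vertex t i) (vertex t j)) ∨ adj G (h i) (h j))}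
              es (∈ₚ.∈-allFin (index x)))
            (∈ₚ.∈-allFin (index y)))
          (≡.trans (cong₂ vertexAdj (vertex-index x) (vertex-index y)) p)
      }
    from : respects t ρ (h ∘ index) ≡ true → isHom (graph t) G h ≡ true
    from e = ∧-intro
      (allB⁺ (allFin (order t)) λ i _ → allB⁺ (allFin (order t)) λ j _ → ⇒-intro λ p → ≡.trans
        (cong₂ (λ x y → adj G (h x) (h y)) (≡.sym (index-vertex t i)) (≡.sym (index-vertex t j)))
        (on-edges H (vertex t i) (vertex t j) p))
      (allB⁺ (allFin (order t)) λ i _ → ≡.trans
        (cong (λ x → eqFin (colour (vertex t i)) (col G (h x))) (≡.sym (index-vertex t i)))
        (on-colours H (vertex t i)))
      where H = respects⇒hom t ρ _ e

_⧺_ : (Fin m → X) → (Fin n → X) → Fin (m + n) → X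
_⧺_ {m} f g i = Sum.[ f , g ] (splitAt m i)

∑-allFuns-suc : ∀ m n (Φ : (Fin (suc m) → Fin n) → ℕ) →
  ∑ (allFuns (suc m) n) Φ ≡ ∑ (allFuns m n) (λ f → ∑ (allFin n) (λ v → Φ (consF v f)))
∑-allFuns-suc m n Φ = ≡.trans (∑-concatMap _ (allFuns m n) Φ)
  (∑-cong (allFuns m n) λ f → ∑-map (λ v → consF v f) (allFin n) Φ)

-- `consF v (f ⧺ g)` and `consF v f ⧺ g` are equal only pointwise, hence the demand that `Φ` respect
-- `≗`.
∑-allFuns-+ : ∀ m k n (Φ : (Fin (m + k) → Fin n) → ℕ) → (∀ {f g} → f ≗ g → Φ f ≡ Φ g) →
  ∑ (allFuns (m + k) n) Φ ≡ ∑ (allFuns m n) (λ f → ∑ (allFuns k n) (λ g → Φ (f ⧺ g)))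
∑-allFuns-+ zero    k n Φ ext = ≡.sym (ℕₚ.+-identityʳ _)
∑-allFuns-+ (suc m) k n Φ ext = begin
  ∑ (allFuns (suc m + k) n) Φ
    ≡⟨ ∑-allFuns-suc (m + k) n Φ ⟩
  ∑ (allFuns (m + k) n) (λ h → ∑ (allFin n) (λ v → Φ (consF v h)))
    ≡⟨ ∑-allFuns-+ m k n _ (λ e → ∑-cong (allFin n) (λ v → ext (consF-cong v e))) ⟩
  ∑ (allFuns m n) (λ f → ∑ (allFuns k n) (λ g → ∑ (allFin n) (λ v → Φ (consF v (f ⧺ g)))))
    ≡⟨ ∑-cong (allFuns m n) (λ f → ∑-swap (allFuns k n) (allFin n) _) ⟩
  ∑ (allFuns m n) (λ f → ∑ (allFin n) (λ v → ∑ (allFuns k n) (λ g → Φ (consF v (f ⧺ g)))))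
    ≡⟨ ∑-cong (allFuns m n) (λ f → ∑-cong (allFin n) (λ v → ∑-cong (allFuns k n) (λ g → ext (consF-⧺ v f g)))) ⟩
  ∑ (allFuns m n) (λ f → ∑ (allFin n) (λ v → ∑ (allFuns k n) (λ g → Φ (consF v f ⧺ g))))
    ≡⟨ ∑-allFuns-suc m n _ ⟨
  ∑ (allFuns (suc m) n) (λ f → ∑ (allFuns k n) (λ g → Φ (f ⧺ g)))
    ∎
  where
  open ≡-Reasoning
  consF-cong : ∀ {l} v {f g : Fin l → Fin n} → f ≗ g → consF v f ≗ consF v g
  consF-cong v e zero    = refl
  consF-cong v e (suc i) = e i
  consF-⧺ : ∀ v (f : Fin m → Fin n) (g : Fin k → Fin n) → consF v (f ⧺ g) ≗ consF v f ⧺ g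
  consF-⧺ v f g zero = refl
  consF-⧺ v f g (suc i) with splitAt m i
  ... | inj₁ _ = refl
  ... | inj₂ _ = refl

module _ (G : Graph c) where

  private
    s = size G
    V = Fin s

  -- Once the image of the root is chosen, the vertices below and those beside it are mapped
  -- independently, and the sum splits into a product.
  ∑-respects : ∀ (t : Term c n) ρ → ∑ (allFuns (order t) s) (λ h → b2n (respects G t ρ (h ∘ index))) ≡ val G t ρ
  ∑-respects one            ρ = refl
  ∑-respects (node a S t u) ρ = begin
    ∑ (allFuns (suc (order t + order u)) s) (λ h → b2n (respects G (node a S t u) ρ (h ∘ index)))
      ≡⟨ ∑-allFuns-suc (order t + order u) s _ ⟩
    ∑ (allFuns (order t + order u) s) (λ h → ∑ (allFin s) (λ v → b2n (respects G (node a S t u) ρ (consF v h ∘ index))))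
      ≡⟨ ∑-swap (allFuns (order t + order u) s) (allFin s) _ ⟩
    ∑ (allFin s) (λ v → ∑ (allFuns (order t + order u) s) (λ h → b2n (respects G (node a S t u) ρ (consF v h ∘ index))))
      ≡⟨ ∑-cong (allFin s) (λ v → ≡.trans (factor v) (≡.sym (ℕₚ.*-assoc (b2n (fits G a S ρ v)) _ _))) ⟩
    ∑ (allFin s) (λ v → b2n (fits G a S ρ v) * val G t (consF v ρ) * val G u ρ)
      ≡⟨ ∑-*ʳ (allFin s) _ (val G u ρ) ⟩
    val G (node a S t u) ρ
      ∎
    where
    open ≡-Reasoning
    factor : ∀ v → ∑ (allFuns (order t + order u) s) (λ h → b2n (respects G (node a S t u) ρ (consF v h ∘ index))) ≡
      b2n (fits G a S ρ v) * (val G t (consF v ρ) * val G u ρ)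
    factor v = begin
      ∑ (allFuns (order t + order u) s) (λ h → b2n (respects G (node a S t u) ρ (consF v h ∘ index)))
        ≡⟨ ∑-allFuns-+ (order t) (order u) s _ (λ {h} {h'} e → cong b2n (respects-cong G (node a S t u) ρ (extend h h' e))) ⟩
      ∑ (allFuns (order t) s) (λ f → ∑ (allFuns (order u) s) (λ g →
        b2n (respects G (node a S t u) ρ (consF v (f ⧺ g) ∘ index))))
        ≡⟨ ∑-cong (allFuns (order t) s) (λ f → ∑-cong (allFuns (order u) s) (λ g → separate f g)) ⟩
      ∑ (allFuns (order t) s) (λ f → ∑ (allFuns (order u) s) (λ g →
        b2n (fits G a S ρ v) * (b2n (respects G t (consF v ρ) (f ∘ index)) * b2n (respects G u ρ (g ∘ index)))))
        ≡⟨ ∑-cong (allFuns (order t) s) (λ f → ≡.trans (∑-*ˡ (allFuns (order u) s) _ (b2n (fits G a S ρ v))) (cong (b2n (fits G a S ρ v) *_)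
             (≡.trans (∑-*ˡ (allFuns (order u) s) _ (b2n (respects G t (consF v ρ) (f ∘ index)))) (cong (b2n (respects G t (consF v ρ) (f ∘ index)) *_) (∑-respects u ρ))))) ⟩
      ∑ (allFuns (order t) s) (λ f → b2n (fits G a S ρ v) * (b2n (respects G t (consF v ρ) (f ∘ index)) * val G u ρ))
        ≡⟨ ≡.trans (∑-*ˡ (allFuns (order t) s) _ (b2n (fits G a S ρ v))) (cong (b2n (fits G a S ρ v) *_)
             (≡.trans (∑-*ʳ (allFuns (order t) s) _ _) (cong (_* val G u ρ) (∑-respects t (consF v ρ))))) ⟩
      b2n (fits G a S ρ v) * (val G t (consF v ρ) * val G u ρ)
        ∎
      where
      extend : ∀ (h h' : Fin (order t + order u) → V) → h ≗ h' →
        ∀ (x : Vertex (node a S t u)) → consF v h (index x) ≡ consF v h' (index x)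
      extend h h' e root        = refl
      extend h h' e (child x)   = e _
      extend h h' e (sibling x) = e _
      separate : ∀ f g → b2n (respects G (node a S t u) ρ (consF v (f ⧺ g) ∘ index)) ≡
        b2n (fits G a S ρ v) * (b2n (respects G t (consF v ρ) (f ∘ index)) * b2n (respects G u ρ (g ∘ index)))
      separate f g = ≡.trans (b2n-∧ (fits G a S ρ v) _) (cong (b2n (fits G a S ρ v) *_)
        (≡.trans (b2n-∧ (respects G t (consF v ρ) (k ∘ child)) _) (cong₂ (λ x y → b2n x * b2n y)
          (respects-cong G t (consF v ρ) {k ∘ child} λ x → cong Sum.[ f , g ] (Finₚ.splitAt-↑ˡ (order t) (index x) (order u)))
          (respects-cong G u ρ {k ∘ sibling} λ x → cong Sum.[ f , g ] (Finₚ.splitAt-↑ʳ (order t) (order u) (index x))))))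
        where
        k : Vertex (node a S t u) → V
        k x = consF v (f ⧺ g) (index x)

  hom≡val : ∀ (t : Term c 0) ρ → hom (graph t) G ≡ val G t ρ
  hom≡val t ρ = ≡.trans (countB≡∑ (allFuns (order t) s) _)
    (≡.trans (∑-cong (allFuns (order t) s) (λ h → cong b2n (isHom≡respects G t h ρ))) (∑-respects t ρ))

-- Definability of thresholds on counts.

Query : ℕ → ℕ → Set → Set
Query c n A = (G : Graph c) → (Fin n → Fin (size G)) → A

Definable : ℕ → Query c n Bool → Set
Definable {c} {n} r P = Σ (Formula c n) λ φ → qr φ ≤ r × (∀ G ρ → sat G φ ρ ≡ P G ρ)

-- The logic has no numerical terms, so a number is represented by all its thresholds, with formulas
-- depending on the threshold but not on the graph.
AtLeast : ℕ → Query c n ℕ → Set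
AtLeast r f = ∀ a → Definable r (λ G ρ → ⌊ a ≤? f G ρ ⌋)

anyB : List X → (X → Bool) → Bool
anyB []       p = false
anyB (x ∷ xs) p = p x ∨ anyB xs p

anyB-⁺ : ∀ {xs : List X} {p x} → x ∈ xs → p x ≡ true → anyB xs p ≡ true
anyB-⁺     (here refl) e rewrite e = refl
anyB-⁺ {xs = y ∷ _} {p} (there q) e rewrite anyB-⁺ {p = p} q e = Bool.∨-zeroʳ (p y)

anyB-⁻ : ∀ (xs : List X) {p} → anyB xs p ≡ true → ∃ λ x → p x ≡ true
anyB-⁻ (x ∷ xs) {p} e with p x in q
... | true  = x , q
... | false = anyB-⁻ xs e

definable-ext : ∀ {r} {P Q : Query c n Bool} → (∀ G ρ → P G ρ ≡ Q G ρ) → Definable r P → Definable r Q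
definable-ext e (φ , le , s) = φ , le , λ G ρ → ≡.trans (s G ρ) (e G ρ)

definable-mono : ∀ {r s} {P : Query c n Bool} → r ≤ s → Definable r P → Definable s P
definable-mono le (φ , le' , s) = φ , ℕₚ.≤-trans le' le , s

definable-not : ∀ {r} {P : Query c n Bool} → Definable r P → Definable r (λ G ρ → not (P G ρ))
definable-not (φ , le , s) = neg φ , le , λ G ρ → cong not (s G ρ)

definable-∨ : ∀ {r} {P Q : Query c n Bool} → Definable r P → Definable r Q → Definable r (λ G ρ → P G ρ ∨ Q G ρ)
definable-∨ (φ , le , s) (ψ , le' , s') = disj φ ψ , ℕₚ.⊔-lub le le' , λ G ρ → cong₂ _∨_ (s G ρ) (s' G ρ)

definable-∧ : ∀ {r} {P Q : Query c n Bool} → Definable r P → Definable r Q → Definable r (λ G ρ → P G ρ ∧ Q G ρ)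
definable-∧ {P = P} {Q} p q = definable-ext (λ G ρ → deMorgan (P G ρ) (Q G ρ))
  (definable-not (definable-∨ (definable-not p) (definable-not q)))
  where
  deMorgan : ∀ a b → not (not a ∨ not b) ≡ a ∧ b
  deMorgan true  true  = refl
  deMorgan true  false = refl
  deMorgan false b     = refl

-- Without variables there is no formula of rank 0, not even a true one. Truth is therefore supplied
-- from outside: `eq zero zero` if a variable is in scope, `∃≥ 0` if the rank is positive.
module _ {c n r : ℕ} (top : Definable {c} {n} r (λ _ _ → true)) where

  definable-const : ∀ b → Definable {c} {n} r (λ _ _ → b)
  definable-const true  = top
  definable-const false = definable-not top

  definable-any : ∀ (xs : List X) {P : X → Query c n Bool} → (∀ x → Definable r (P x)) →
    Definable r (λ G ρ → anyB xs (λ x → P x G ρ))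
  definable-any []       h = definable-const false
  definable-any (x ∷ xs) h = definable-∨ (h x) (definable-any xs h)

  definable-all : ∀ (xs : List X) {P : X → Query c n Bool} → (∀ x → Definable r (P x)) →
    Definable r (λ G ρ → allB xs (λ x → P x G ρ))
  definable-all []       h = top
  definable-all (x ∷ xs) h = definable-∧ (h x) (definable-all xs h)

  atLeast-b2n : ∀ {P : Query c n Bool} → Definable r P → AtLeast r (λ G ρ → b2n (P G ρ))
  atLeast-b2n     p zero          = top
  atLeast-b2n {P} p (suc zero)    = definable-ext (λ G ρ → threshold (P G ρ)) p
    where
    threshold : ∀ b → b ≡ ⌊ 1 ≤? b2n b ⌋
    threshold true  = refl
    threshold false = refl
  atLeast-b2n {P} p (suc (suc a)) = definable-ext
    (λ G ρ → ≡.sym (dec-false (suc (suc a) ≤? b2n (P G ρ)) λ le → ℕₚ.<⇒≱ (s≤s (s≤s z≤n)) (ℕₚ.≤-trans le (b2n≤1 (P G ρ)))))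
    (definable-const false)

  atLeast-+ : ∀ {f g : Query c n ℕ} → AtLeast r f → AtLeast r g → AtLeast r (λ G ρ → f G ρ + g G ρ)
  atLeast-+ {f} {g} df dg a = definable-ext (λ G ρ → split (f G ρ) (g G ρ))
    (definable-any (upTo (suc a)) (λ b → definable-∧ (df b) (dg (a ∸ b))))
    where
    split : ∀ x y → anyB (upTo (suc a)) (λ b → ⌊ b ≤? x ⌋ ∧ ⌊ a ∸ b ≤? y ⌋) ≡ ⌊ a ≤? x + y ⌋
    split x y = bool-ext to from
      where
      to : anyB (upTo (suc a)) (λ b → ⌊ b ≤? x ⌋ ∧ ⌊ a ∸ b ≤? y ⌋) ≡ true → ⌊ a ≤? x + y ⌋ ≡ true
      to e with anyB-⁻ (upTo (suc a)) e
      ... | b , e' with ∧-true {⌊ b ≤? x ⌋} e'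
      ...   | p , q = dec-true (a ≤? x + y) (ℕₚ.≤-trans (ℕₚ.m≤n+m∸n a b)
        (ℕₚ.+-mono-≤ (true-dec (b ≤? x) p) (true-dec (a ∸ b ≤? y) q)))
      from : ⌊ a ≤? x + y ⌋ ≡ true → anyB (upTo (suc a)) (λ b → ⌊ b ≤? x ⌋ ∧ ⌊ a ∸ b ≤? y ⌋) ≡ true
      -- Cutting `x` down to `a` keeps the witness within a finite range independent of the graph.
      from e = anyB-⁺ (∈ₚ.∈-upTo⁺ (s≤s (ℕₚ.m⊓n≤n x a))) (∧-intro
        (dec-true (x ⊓ a ≤? x) (ℕₚ.m⊓n≤m x a))
        (dec-true (a ∸ (x ⊓ a) ≤? y) remainder))
        where
        remainder : a ∸ (x ⊓ a) ≤ y
        remainder with ℕₚ.≤-total x a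
        ... | inj₁ x≤a rewrite ℕₚ.m≤n⇒m⊓n≡m x≤a = ℕₚ.m≤n+o⇒m∸n≤o a x (true-dec (a ≤? x + y) e)
        ... | inj₂ a≤x rewrite ℕₚ.m≥n⇒m⊓n≡n a≤x | ℕₚ.n∸n≡0 a = z≤n

  atLeast-* : ∀ {f g : Query c n ℕ} → AtLeast r f → AtLeast r g → AtLeast r (λ G ρ → f G ρ * g G ρ)
  atLeast-* {f} {g} df dg a = definable-ext (λ G ρ → split (f G ρ) (g G ρ))
    (definable-any (upTo (suc a)) λ b → definable-any (upTo (suc a)) λ b' →
      definable-∧ (definable-const ⌊ a ≤? b * b' ⌋) (definable-∧ (df b) (dg b')))
    where
    split : ∀ x y →
      anyB (upTo (suc a)) (λ b → anyB (upTo (suc a)) λ b' → ⌊ a ≤? b * b' ⌋ ∧ ⌊ b ≤? x ⌋ ∧ ⌊ b' ≤? y ⌋) ≡ ⌊ a ≤? x * y ⌋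
    split x y = bool-ext to from
      where
      to : anyB (upTo (suc a)) (λ b → anyB (upTo (suc a)) λ b' → ⌊ a ≤? b * b' ⌋ ∧ ⌊ b ≤? x ⌋ ∧ ⌊ b' ≤? y ⌋) ≡ true →
        ⌊ a ≤? x * y ⌋ ≡ true
      to e with anyB-⁻ (upTo (suc a)) e
      ... | b , e₁ with anyB-⁻ (upTo (suc a)) e₁
      ...   | b' , e₂ with ∧-true {⌊ a ≤? b * b' ⌋} e₂
      ...     | p , e₃ with ∧-true {⌊ b ≤? x ⌋} e₃
      ...       | q , q' = dec-true (a ≤? x * y) (ℕₚ.≤-trans (true-dec (a ≤? b * b') p)
        (ℕₚ.*-mono-≤ (true-dec (b ≤? x) q) (true-dec (b' ≤? y) q')))
      absorb : ∀ x y → a ≤ x * y → a ≤ x * a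
      absorb zero    y le = le
      absorb (suc x) y le = ℕₚ.m≤m+n a _
      square : ∀ a → a ≤ a * a
      square zero    = z≤n
      square (suc a) = ℕₚ.m≤m+n (suc a) _
      -- If one factor is cut down to `a`, the other is positive unless `a` is 0, so the product
      -- still reaches `a`.
      product : a ≤ x * y → a ≤ (x ⊓ a) * (y ⊓ a)
      product le with ℕₚ.≤-total x a | ℕₚ.≤-total y a
      ... | inj₁ p | inj₁ q rewrite ℕₚ.m≤n⇒m⊓n≡m p | ℕₚ.m≤n⇒m⊓n≡m q = le
      ... | inj₁ p | inj₂ q rewrite ℕₚ.m≤n⇒m⊓n≡m p | ℕₚ.m≥n⇒m⊓n≡n q = absorb x y le
      ... | inj₂ p | inj₁ q rewrite ℕₚ.m≥n⇒m⊓n≡n p | ℕₚ.m≤n⇒m⊓n≡m q =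
        subst (a ≤_) (ℕₚ.*-comm y a) (absorb y x (subst (a ≤_) (ℕₚ.*-comm x y) le))
      ... | inj₂ p | inj₂ q rewrite ℕₚ.m≥n⇒m⊓n≡n p | ℕₚ.m≥n⇒m⊓n≡n q = square a
      from : ⌊ a ≤? x * y ⌋ ≡ true →
        anyB (upTo (suc a)) (λ b → anyB (upTo (suc a)) λ b' → ⌊ a ≤? b * b' ⌋ ∧ ⌊ b ≤? x ⌋ ∧ ⌊ b' ≤? y ⌋) ≡ true
      from e = anyB-⁺ (∈ₚ.∈-upTo⁺ (s≤s (ℕₚ.m⊓n≤n x a))) (anyB-⁺ (∈ₚ.∈-upTo⁺ (s≤s (ℕₚ.m⊓n≤n y a))) (∧-intro
        (dec-true (a ≤? (x ⊓ a) * (y ⊓ a)) (product (true-dec (a ≤? x * y) e)))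
        (∧-intro (dec-true (x ⊓ a ≤? x) (ℕₚ.m⊓n≤m x a)) (dec-true (y ⊓ a ≤? y) (ℕₚ.m⊓n≤m y a)))))

  atLeast-∑ : ∀ (xs : List X) {f : X → Query c n ℕ} → (∀ x → AtLeast r (f x)) → AtLeast r (λ G ρ → ∑ xs (λ x → f x G ρ))
  atLeast-∑ []       h zero    = top
  atLeast-∑ []       h (suc a) = definable-const false
  atLeast-∑ (x ∷ xs) h         = atLeast-+ (h x) (atLeast-∑ xs h)

∑-thresholds : ∀ a m → ∑ (downFrom a) (λ b → b2n ⌊ suc b ≤? m ⌋) ≡ m ⊓ a
∑-thresholds zero    m = ≡.sym (ℕₚ.⊓-zeroʳ m)
∑-thresholds (suc a) m rewrite ∑-thresholds a m with suc a ≤? m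
... | yes a<m rewrite ℕₚ.m≥n⇒m⊓n≡n a<m = cong suc (ℕₚ.m≥n⇒m⊓n≡n (ℕₚ.<⇒≤ a<m))
... | no  a≮m = ≡.trans (ℕₚ.m≤n⇒m⊓n≡m m≤a) (≡.sym (ℕₚ.m≤n⇒m⊓n≡m (ℕₚ.m≤n⇒m≤1+n m≤a)))
  where m≤a = ℕₚ.≮⇒≥ a≮m

-- The threshold `b` is separated from the truncation level `a` for the induction: a term of size at
-- least `a` settles it alone, a smaller one leaves the remainder `b ∸ f x`.
∑-truncate : ∀ a (xs : List X) (f : X → ℕ) → ∀ b → b ≤ a → b ≤ ∑ xs f → b ≤ ∑ xs (λ x → f x ⊓ a)
∑-truncate a []       f b b≤a le = le
∑-truncate a (x ∷ xs) f b b≤a le with ℕₚ.≤-total a (f x)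
... | inj₁ a≤fx rewrite ℕₚ.m≥n⇒m⊓n≡n a≤fx = ℕₚ.≤-trans b≤a (ℕₚ.m≤m+n a _)
... | inj₂ fx≤a rewrite ℕₚ.m≤n⇒m⊓n≡m fx≤a = ℕₚ.≤-trans (ℕₚ.m≤n+m∸n b (f x))
  (ℕₚ.+-monoʳ-≤ (f x) (∑-truncate a xs f (b ∸ f x) (ℕₚ.≤-trans (ℕₚ.m∸n≤m b (f x)) b≤a) (ℕₚ.m≤n+o⇒m∸n≤o b (f x) le)))

-- A sum of natural numbers is at least a iff the same holds for Σ_{b < a} #{v : f v > b}.
atLeast-∑vertices : ∀ {r} {f : Query c (suc n) ℕ} → AtLeast r f →
  AtLeast (suc r) (λ G ρ → ∑ (allFin (size G)) (λ v → f G (consF v ρ)))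
atLeast-∑vertices {c} {n} {r} {f} df a = definable-ext (λ G ρ → truncate G ρ)
  (atLeast-∑ top (downFrom a) {λ b G ρ → countB (allFin (size G)) (λ v → ⌊ suc b ≤? f G (consF v ρ) ⌋)} count a)
  where
  top : Definable (suc r) (λ _ _ → true)
  top = ∃≥ 0 (eq zero zero) , s≤s z≤n , λ _ _ → refl
  count : ∀ b → AtLeast (suc r) (λ G ρ → countB (allFin (size G)) (λ v → ⌊ suc b ≤? f G (consF v ρ) ⌋))
  count b a with df (suc b)
  ... | φ , le , s = ∃≥ a φ , s≤s le , λ G ρ → cong (λ k → ⌊ a ≤? k ⌋)
    (≡.trans (countB≡∑ (allFin (size G)) _)
      (≡.trans (∑-cong (allFin (size G)) (λ v → cong b2n (s G (consF v ρ)))) (≡.sym (countB≡∑ (allFin (size G)) _))))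
  truncate : ∀ G ρ → ⌊ a ≤? ∑ (downFrom a) (λ b → countB (allFin (size G)) (λ v → ⌊ suc b ≤? f G (consF v ρ) ⌋)) ⌋ ≡
    ⌊ a ≤? ∑ (allFin (size G)) (λ v → f G (consF v ρ)) ⌋
  truncate G ρ = ≡.trans (cong (λ k → ⌊ a ≤? k ⌋) layers) (bool-ext
    (λ e → dec-true (a ≤? _) (ℕₚ.≤-trans (true-dec (a ≤? _) e)
      (∑-mono (allFin (size G)) (λ v → ℕₚ.m⊓n≤m (f G (consF v ρ)) a))))
    (λ e → dec-true (a ≤? _) (∑-truncate a (allFin (size G)) (λ v → f G (consF v ρ)) a ℕₚ.≤-refl (true-dec (a ≤? _) e))))
    where
    layers : ∑ (downFrom a) (λ b → countB (allFin (size G)) (λ v → ⌊ suc b ≤? f G (consF v ρ) ⌋)) ≡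
      ∑ (allFin (size G)) (λ v → f G (consF v ρ) ⊓ a)
    layers = ≡.trans (∑-cong (downFrom a) (λ b → countB≡∑ (allFin (size G)) _))
      (≡.trans (∑-swap (downFrom a) (allFin (size G)) _)
               (∑-cong (allFin (size G)) (λ v → ∑-thresholds a (f G (consF v ρ)))))

atLeast-mono : ∀ {r s} {f : Query c n ℕ} → r ≤ s → AtLeast r f → AtLeast s f
atLeast-mono {f = f} le df a = definable-mono {P = λ G ρ → ⌊ a ≤? f G ρ ⌋} le (df a)

true-positive : ∀ {r} → Definable {c} {suc n} r (λ _ _ → true)
true-positive = eq zero zero , z≤n , λ G ρ → eqFin-refl (ρ zero)

definable-fits : ∀ {r} (a : Fin c) (S : List (Fin n)) →
  Definable r (λ G (ρ : Fin (suc n) → Fin (size G)) → fits G a S (ρ ∘ suc) (ρ zero))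
definable-fits a S = definable-∧
  (colr zero a , z≤n , λ G ρ → bool-ext
    (λ e → subst (λ b → eqFin a b ≡ true) (≡.sym (eqFin⇒≡ e)) (eqFin-refl a))
    (λ e → subst (λ b → eqFin b a ≡ true) (eqFin⇒≡ e) (eqFin-refl a)))
  (definable-all true-positive S λ i → edge (suc i) zero , z≤n , λ G ρ → refl)

-- A forest may have depth 0 and then needs a variable to express truth. A single tree has positive
-- rank, so `atLeast-root` also covers sentences.
atLeast-val : (t : Term c (suc n)) → AtLeast (depth t) (λ G → val G t)
atLeast-root : (a : Fin c) (S : List (Fin n)) (t : Term c (suc n)) → AtLeast (suc (depth t))
  (λ G ρ → ∑ (allFin (size G)) (λ v → b2n (fits G a S ρ v) * val G t (consF v ρ)))
atLeast-val one            = atLeast-b2n true-positive true-positive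
atLeast-val (node a S t u) = atLeast-* true-positive
  (atLeast-mono {f = λ G ρ → ∑ (allFin (size G)) (λ v → b2n (fits G a S ρ v) * val G t (consF v ρ))}
    (ℕₚ.m≤m⊔n (suc (depth t)) (depth u)) (atLeast-root a S t))
  (atLeast-mono {f = λ G → val G u} (ℕₚ.m≤n⊔m (suc (depth t)) (depth u)) (atLeast-val u))
atLeast-root a S t = atLeast-∑vertices
  {f = λ G ρ → b2n (fits G a S (ρ ∘ suc) (ρ zero)) * val G t ρ}
  (atLeast-* true-positive (atLeast-b2n true-positive (definable-fits a S)) (atLeast-val t))

-- The family of graphs and the equivalence.

pattern-graph : Branch c 0 → Graph c
pattern-graph b = graph (tree b)

thresholds⇒≡ : ∀ {x y} → (∀ a → ⌊ a ≤? x ⌋ ≡ ⌊ a ≤? y ⌋) → x ≡ y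
thresholds⇒≡ {x} {y} h = ℕₚ.≤-antisym
  (true-dec (x ≤? y) (≡.trans (≡.sym (h x)) (dec-true (x ≤? x) ℕₚ.≤-refl)))
  (true-dec (y ≤? x) (≡.trans (h y) (dec-true (y ≤? y) ℕₚ.≤-refl)))

Ck-equiv⇒hom≡ : ∀ {k} {G G' : Graph c} → Ck-equiv k G G' → ∀ b → LinkedUpTo k b →
  hom (pattern-graph b) G ≡ hom (pattern-graph b) G'
Ck-equiv⇒hom≡ {k = k} {G} {G'} equiv b@(a , S , t) (_ , le) = thresholds⇒≡ λ p →
  let φ , φ≤ , defines = atLeast-root a S t p
      models≡ : ∀ H → models H φ ≡ ⌊ p ≤? hom (pattern-graph b) H ⌋
      models≡ H = ≡.trans (defines H _)
        (cong (λ x → ⌊ p ≤? x ⌋) (≡.trans (≡.sym (ℕₚ.*-identityʳ _)) (≡.sym (hom≡val H (tree b) _))))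
  in ≡.trans (≡.sym (models≡ G)) (≡.trans (equiv φ (ℕₚ.≤-trans φ≤ le)) (models≡ G'))

treeDepth-mono : ∀ {j k} {G : Graph c} → j ≤ k → TreeDepth≤ G j → TreeDepth≤ G k
treeDepth-mono le (Fo , elim , height) = Fo , elim , λ xs chain → ℕₚ.≤-trans (height xs chain) le

hom≡⇒Ck-equiv : ∀ {k d} {G G' : Graph c} → MaxDegree≤ G d → MaxDegree≤ G' d →
  All (λ b → hom (pattern-graph b) G ≡ hom (pattern-graph b) G') (test-branches d k 0) → Ck-equiv k G G'
hom≡⇒Ck-equiv {k = k} {G = G} {G'} deg deg' homs φ le = similar⇒sat G G' deg deg' k φ _ _ le (similar _ _)
  where
  similar : ∀ ρ ρ' → Similar G G' (test-branches _ k 0) ρ ρ'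
  similar ρ ρ' = record { same-eq = λ () ; same-adj = λ () ; same-col = λ () }
    , All.map (λ {b} e → ≡.trans (≡.sym (hom≡val G (tree b) ρ)) (≡.trans e (hom≡val G' (tree b) ρ'))) homs

-- Computability of the family is rendered by its being an actual function from `k` and `d` to lists
-- of graphs.
theorem22 : (c : ℕ) →
    Σ (ℕ → ℕ → List (Graph c)) λ ℱ →
    ∀ (k d : ℕ) → 1 ≤ k → 1 ≤ d →
    All (λ F → TreeDepth≤ F k) (ℱ k d)
    × (∀ (G G' : Graph c) → MaxDegree≤ G d → MaxDegree≤ G' d →
    (All (λ F → hom F G ≡ hom F G') (ℱ k d) ⇔ Ck-equiv k G G'))
theorem22 c = (λ k d → map pattern-graph (test-branches d k 0)) , λ k d _ _ →
    Allₚ.map⁺ (All.map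
      (λ { {b} (_ , le) → treeDepth-mono {G = pattern-graph b} (ℕₚ.⊔-lub le z≤n) (treeDepth-graph (tree b)) })
      (test-linked d k 0))
  , λ G G' deg deg' → mk⇔
      (λ homs → hom≡⇒Ck-equiv deg deg' (Allₚ.map⁻ homs))
      (λ equiv → Allₚ.map⁺ (All.map (λ {b} → Ck-equiv⇒hom≡ equiv b) (test-linked d k 0)))
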